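{- Let $A$ be a finite set of natural numbers which is a subset of a bi-arithmetic progression $I\cup J$ such that $|A|=k>10$ and both $A\cap I$ and $A\cap J$ are non-empty. If $|2A|=3k-3+b$ with $0\leqslant b<\frac13k-2$, then $I$ and $J$ can be chosen so that $|I|+|J|\leqslant k+b$; that is, there is a bi-arithmetic progression $I'\cup J'$ with $A\subseteq I'\cup J'$, $A\cap I'\neq\emptyset$, $A\cap J'\neq\emptyset$, and $|I'|+|J'|\leqslant k+b$.
   Context: $2A=A+A=\{a+a':a,a'\in A\}$. For non-negative integers $a,d,k$ with $d,k\geqslant 1$, the set $\{a,a+d,\ldots,a+(k-1)d\}$ is an arithmetic progression of length $k$ with difference $d$. A bi-arithmetic progression of length $k$ with difference $d$ is a set of the form $I\cup J$ where $I$ and $J$ are arithmetic progressions of difference $d$, $|I|+|J|=k$, and $I+I$, $I+J$, $J+J$ are pairwise disjoint. -}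

module Defs where

open import Data.List using (List; length; deduplicate; cartesianProductWith; applyUpTo)
open import Data.List.Membership.Propositional using (_∈_)
open import Data.List.Relation.Binary.BagAndSetEquality using (_∼[_]_; set)
open import Data.List.Relation.Binary.Disjoint.Propositional using (Disjoint)
open import Data.Nat using (ℕ; _+_; _*_; _≤_; _≟_)
open import Data.Product using (∃-syntax; _×_)
open import Relation.Binary.PropositionalEquality using (_≡_)

-- A finite set of natural numbers is represented by any list enumerating it:
-- order and repetitions are irrelevant, equality of sets is _∼[ set ]_,
-- union is _++_, and cardinality counts distinct entries.
FinSet : Set
FinSet = List ℕ

card : FinSet → ℕ
card A = length (deduplicate _≟_ A)

infixl 6 _⊕_
_⊕_ : FinSet → FinSet → FinSet
A ⊕ B = cartesianProductWith _+_ A B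

infix 4 _meets_
_meets_ : FinSet → FinSet → Set
A meets B = ∃[ x ] (x ∈ A × x ∈ B)

progression : (a d k : ℕ) → FinSet
progression a d k = applyUpTo (λ i → a + i * d) k

record IsAP (d k : ℕ) (I : FinSet) : Set where
  field
    d≥1   : 1 ≤ d
    k≥1   : 1 ≤ k
    terms : ∃[ a ] (I ∼[ set ] progression a d k)

-- The pair (I , J) is kept, rather than only the set I ∪ J, since the pieces
-- are referred to individually.
record IsBiAP (d k : ℕ) (I J : FinSet) : Set where
  field
    I-isAP   : ∃[ m ] IsAP d m I
    J-isAP   : ∃[ n ] IsAP d n J
    size     : card I + card J ≡ k
    II-IJ    : Disjoint (I ⊕ I) (I ⊕ J)
    II-JJ    : Disjoint (I ⊕ I) (J ⊕ J)
    IJ-JJ    : Disjoint (I ⊕ J) (J ⊕ J)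

{-# OPTIONS --safe #-}
-- Write A₁ = A ∩ I and A₂ = A ∩ J, with kᵢ elements, in the index coordinates of I and J. Then 2A is the
-- disjoint union of 2A₁, A₁ + A₂ and 2A₂, of sizes at least 2k₁ − 1, k₁ + k₂ − 1 and 2k₂ − 1. One of the
-- two, say A₁, has k₁ ≥ b + 3; divide by the gcd of its differences, which also divides those of A₂, as
-- otherwise A₁ + A₂ would meet two residue classes and be too large. Now let Aᵢ have diameter ℓᵢ.
-- Freiman's 3k − 4 theorem gives |2A₁| ≥ k₁ + ℓ₁. If k₂ ≥ b + 3 too, it also gives |2A₂| ≥ k₂ + ℓ₂, and adding
-- up finishes the proof. Otherwise A₁ + A₂ ⊇ A₁ ∪ (A₁ + ℓ₂). Take the run W of points x with both
-- x and ℓ₁ + x in 2A₁, between the last x ≤ ℓ₁ outside 2A₁ and the next x with ℓ₁ + x outside 2A₁: every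
-- point of W missing from A₁ increases |2A₁|, while A₁ ∪ (A₁ + ℓ₂) gains |A₁ ∩ W| over |A₁|
-- (W cut to length ℓ₂). Since at least half of the points off W are missing from A₁, W has length
-- at least 2k₁ − ℓ₁ − 1, so |2A₁| + |A₁ + A₂| ≥ min(2k₁ + ℓ₁ + ℓ₂, 4k₁ − 1); the second value is too large.
--
-- Freiman's theorem itself, |2A| ≥ min(3k − 3, k + ℓ) for A ⊆ [0, ℓ] with gcd 1, is by induction on ℓ.
-- If ℓ ≤ 2k − 3, then x or ℓ + x lies in 2A for every x ≤ ℓ. Otherwise, if the last gap of A is at least 2,
-- remove the last element: if the rest P is dense the run W applies, if P has gcd > 1 the count is direct,
-- and else there are three new sums. The same applies to the first gap. If both gaps are 1, there are
-- consecutive elements u < v for which the bounds for A ∩ [0, v] and A ∩ [u, ℓ] add up to 3k − 3.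
module Submission where

open import Defs
open import Data.Bool using (Bool; true; false; _∧_; _∨_; not; if_then_else_)
open import Data.Empty using (⊥; ⊥-elim)
open import Data.List using ([]; _∷_; _++_; length)
open import Data.List.Membership.Propositional using (_∈_)
open import Data.List.Membership.Propositional.Properties using (∈-∃++; ∈-++⁺ˡ; ∈-++⁺ʳ; ∈-++⁻; ∈-deduplicate⁺; ∈-deduplicate⁻; ∈-applyUpTo⁺; ∈-applyUpTo⁻; ∈-cartesianProductWith⁺; ∈-cartesianProductWith⁻)
open import Data.List.Properties using (length-++; length-applyUpTo)
open import Data.List.Relation.Binary.Disjoint.Propositional using (Disjoint)
open import Data.List.Relation.Binary.Subset.Propositional using (_⊆_)
open import Data.List.Relation.Unary.All using (lookup; tabulate)
open import Data.List.Relation.Unary.Any using (here; there)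
open import Data.List.Relation.Unary.Unique.Propositional using (Unique; []; _∷_)
open import Data.List.Relation.Unary.Unique.Propositional.Properties using (++⁺)
open import Data.Nat
open import Data.Nat.Divisibility
open import Data.Nat.GCD using (gcd; gcd[m,n]∣m; gcd[m,n]∣n; gcd-greatest)
open import Data.Nat.Induction using (<-rec)
open import Data.Nat.Properties
open import Data.Nat.Tactic.RingSolver using (solve)
open import Data.List.Membership.DecPropositional _≟_ using (_∈?_)
open import Data.List.Relation.Unary.Unique.DecPropositional.Properties _≟_ using (deduplicate-!)
open import Data.Product using (∃-syntax; _×_; _,_; proj₁; proj₂)
open import Data.Sum using (_⊎_; inj₁; inj₂; map; map₁)
open import Function using (mk⇔; Equivalence; id; _∘_)
open import Function.Definitions using (Injective)
open import Relation.Binary.PropositionalEquality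
open import Relation.Nullary using (Dec; yes; no; ¬_; does)
open import Relation.Nullary.Decidable using (dec-true; dec-false)

-- Counting the points of a decidable set below a bound

-- From x ≤ y and a linear identity in which s is the slack; long hypotheses are summed into x ≤ y.
lin : ∀ {x y} L R s → x ≤ y → L + y + s ≡ R + x → L ≤ R
lin {x} {y} L R s x≤y eq = +-cancelʳ-≤ y L R (begin
  L + y     ≤⟨ m≤m+n (L + y) s ⟩
  L + y + s ≡⟨ eq ⟩
  R + x     ≤⟨ +-monoʳ-≤ R x≤y ⟩
  R + y     ∎)
  where open ≤-Reasoning

Pred : Set
Pred = ℕ → Bool

infix 4 _∋_
_∋_ : Pred → ℕ → Set
P ∋ x = P x ≡ true

infixr 5 _▸_
_▸_ : ℕ → Pred → Pred
(s ▸ P) i = P (s + i)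

bit : Bool → ℕ
bit true  = 1
bit false = 0

-- The recursion shifts the set, so that the count over [s, s + n) is `cnt (s ▸ P) n` and counts are
-- never subtracted.
cnt : Pred → ℕ → ℕ
cnt P zero    = 0
cnt P (suc n) = bit (P 0) + cnt (1 ▸ P) n

infixl 6 _∩_
_∩_ : Pred → Pred → Pred
(P ∩ Q) x = P x ∧ Q x

∩-intro : ∀ P Q {x} → P ∋ x → Q ∋ x → P ∩ Q ∋ x
∩-intro P Q p q rewrite p = q

∧-elim : ∀ {a b} → a ∧ b ≡ true → a ≡ true × b ≡ true
∧-elim {true} b≡true = refl , b≡true

witness : ∀ {P : Set} (P? : Dec P) → does P? ≡ true → P
witness (yes p) _ = p

true≢false : ∀ {b} → b ≡ true → b ≡ false → ⊥
true≢false refl ()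

bit-mono : ∀ {a b} → (a ≡ true → b ≡ true) → bit a ≤ bit b
bit-mono {false} imp = z≤n
bit-mono {true}  imp rewrite imp refl = ≤-refl

bit≤1 : ∀ b → bit b ≤ 1
bit≤1 true  = ≤-refl
bit≤1 false = z≤n

cnt-mono : ∀ P Q n → (∀ i → i < n → P ∋ i → Q ∋ i) → cnt P n ≤ cnt Q n
cnt-mono P Q zero    imp = z≤n
cnt-mono P Q (suc n) imp =
  +-mono-≤ (bit-mono (imp 0 z<s)) (cnt-mono (1 ▸ P) (1 ▸ Q) n (λ i i<n → imp (suc i) (s<s i<n)))

cnt-split : ∀ P m n → cnt P (m + n) ≡ cnt P m + cnt (m ▸ P) n
cnt-split P zero    n = refl
cnt-split P (suc m) n = begin
  bit (P 0) + cnt (1 ▸ P) (m + n)                     ≡⟨ cong (bit (P 0) +_) (cnt-split (1 ▸ P) m n) ⟩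
  bit (P 0) + (cnt (1 ▸ P) m + cnt (suc m ▸ P) n)     ≡⟨ +-assoc (bit (P 0)) _ _ ⟨
  bit (P 0) + cnt (1 ▸ P) m + cnt (suc m ▸ P) n       ∎
  where open ≡-Reasoning

cnt-splitAt : ∀ P m n {N} → m + n ≡ N → cnt P N ≡ cnt P m + cnt (m ▸ P) n
cnt-splitAt P m n refl = cnt-split P m n

cnt-last : ∀ P n → cnt P (suc n) ≡ cnt P n + bit (P n)
cnt-last P zero    = +-identityʳ (bit (P 0))
cnt-last P (suc n) =
  trans (cong (bit (P 0) +_) (cnt-last (1 ▸ P) n)) (sym (+-assoc (bit (P 0)) _ _))

cnt-last-true : ∀ P n → P ∋ n → cnt P (suc n) ≡ suc (cnt P n)
cnt-last-true P n Pn rewrite cnt-last P n | Pn = +-comm (cnt P n) 1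

cnt-last-false : ∀ P n → P n ≡ false → cnt P (suc n) ≡ cnt P n
cnt-last-false P n Pn rewrite cnt-last P n | Pn = +-identityʳ (cnt P n)

cnt-≤ : ∀ P n → cnt P n ≤ n
cnt-≤ P zero    = z≤n
cnt-≤ P (suc n) = +-mono-≤ (bit≤1 (P 0)) (cnt-≤ (1 ▸ P) n)

cnt-grow : ∀ P {m n} → m ≤ n → cnt P m ≤ cnt P n
cnt-grow P {m} m≤n with m≤n⇒∃[o]m+o≡n m≤n
... | o , refl = ≤-trans (m≤m+n (cnt P m) _) (≤-reflexive (sym (cnt-split P m o)))

cnt-shift : ∀ P s n {N} → s + n ≤ N → cnt (s ▸ P) n ≤ cnt P N
cnt-shift P s n le = ≤-trans (≤-trans (m≤n+m _ (cnt P s)) (≤-reflexive (sym (cnt-split P s n)))) (cnt-grow P le)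

cnt-full : ∀ P n → (∀ i → i < n → P ∋ i) → cnt P n ≡ n
cnt-full P zero    all = refl
cnt-full P (suc n) all rewrite all 0 z<s =
  cong suc (cnt-full (1 ▸ P) n (λ i i<n → all (suc i) (s<s i<n)))

cnt-none : ∀ P n → (∀ i → i < n → P i ≡ false) → cnt P n ≡ 0
cnt-none P zero    none = refl
cnt-none P (suc n) none rewrite none 0 z<s =
  cnt-none (1 ▸ P) n (λ i i<n → none (suc i) (s<s i<n))

cnt-strict : ∀ P Q n j → (∀ i → i < n → P ∋ i → Q ∋ i) → j < n → P j ≡ false → Q ∋ j → suc (cnt P n) ≤ cnt Q n
cnt-strict P Q n j imp j<n Pj Qj with m≤n⇒∃[o]m+o≡n j<n
... | o , refl rewrite cnt-split P (suc j) o | cnt-split Q (suc j) o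
                     | cnt-last-false P j Pj | cnt-last-true Q j Qj =
  s≤s (+-mono-≤ (cnt-mono P Q j (λ i i<j → imp i (≤-trans i<j (≤-trans (n≤1+n j) (m≤m+n (suc j) o)))))
                (cnt-mono (suc j ▸ P) (suc j ▸ Q) o (λ i i<o → imp (suc j + i) (+-monoʳ-< (suc j) i<o))))

interchange : ∀ a b c d → (a + b) + (c + d) ≡ (a + c) + (b + d)
interchange a b c d = solve (a ∷ b ∷ c ∷ d ∷ [])

bit-cover : ∀ {p s t} → s ≡ true ⊎ t ≡ true → (p ≡ true → s ≡ true) → (p ≡ true → t ≡ true) → 1 + bit p ≤ bit s + bit t
bit-cover {true}  _ ps pt rewrite ps refl | pt refl = ≤-refl
bit-cover {false} (inj₁ refl) _ _ = s≤s z≤n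
bit-cover {false} {s} (inj₂ refl) _ _ = m≤n+m 1 (bit s)

-- Inclusion-exclusion for `S` and `T` covering [0, n), with `P` any part of their intersection; it
-- holds point by point.
cnt-cover : ∀ P S T n → (∀ i → i < n → S ∋ i ⊎ T ∋ i) → (∀ i → i < n → P ∋ i → S ∋ i) →
            (∀ i → i < n → P ∋ i → T ∋ i) → n + cnt P n ≤ cnt S n + cnt T n
cnt-cover P S T zero    cov ps pt = z≤n
cnt-cover P S T (suc n) cov ps pt = begin
  1 + n + (bit (P 0) + cnt (1 ▸ P) n)                          ≡⟨ interchange 1 n (bit (P 0)) _ ⟩
  1 + bit (P 0) + (n + cnt (1 ▸ P) n)                          ≤⟨ +-mono-≤
    (bit-cover (cov 0 z<s) (ps 0 z<s) (pt 0 z<s))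
    (cnt-cover (1 ▸ P) (1 ▸ S) (1 ▸ T) n (λ i l → cov (suc i) (s<s l)) (λ i l → ps (suc i) (s<s l)) (λ i l → pt (suc i) (s<s l))) ⟩
  bit (S 0) + bit (T 0) + (cnt (1 ▸ S) n + cnt (1 ▸ T) n)      ≡⟨ interchange (bit (S 0)) (bit (T 0)) _ _ ⟩
  bit (S 0) + cnt (1 ▸ S) n + (bit (T 0) + cnt (1 ▸ T) n)      ∎
  where open ≤-Reasoning

bit-disjoint : ∀ {p q r} → (p ≡ true → r ≡ true) → (q ≡ true → r ≡ true) → (p ≡ true → q ≡ true → ⊥) → bit p + bit q ≤ bit r
bit-disjoint {true}  {true}  _ _ pq = ⊥-elim (pq refl refl)
bit-disjoint {true}  {false} pr _ _ rewrite pr refl = ≤-refl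
bit-disjoint {false} {true}  _ qr _ rewrite qr refl = ≤-refl
bit-disjoint {false} {false} _ _ _ = z≤n

cnt-disjoint : ∀ P Q R n → (∀ i → i < n → P ∋ i → R ∋ i) → (∀ i → i < n → Q ∋ i → R ∋ i) →
               (∀ i → i < n → P ∋ i → Q ∋ i → ⊥) → cnt P n + cnt Q n ≤ cnt R n
cnt-disjoint P Q R zero    pr qr pq = z≤n
cnt-disjoint P Q R (suc n) pr qr pq = begin
  bit (P 0) + cnt (1 ▸ P) n + (bit (Q 0) + cnt (1 ▸ Q) n)      ≡⟨ interchange (bit (P 0)) _ (bit (Q 0)) _ ⟩
  bit (P 0) + bit (Q 0) + (cnt (1 ▸ P) n + cnt (1 ▸ Q) n)      ≤⟨ +-mono-≤
    (bit-disjoint (pr 0 z<s) (qr 0 z<s) (pq 0 z<s))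
    (cnt-disjoint (1 ▸ P) (1 ▸ Q) (1 ▸ R) n (λ i l → pr (suc i) (s<s l)) (λ i l → qr (suc i) (s<s l)) (λ i l → pq (suc i) (s<s l))) ⟩
  bit (R 0) + cnt (1 ▸ R) n                                    ∎
  where open ≤-Reasoning

bit-union : ∀ {p q r} → (r ≡ true → p ≡ true ⊎ q ≡ true) → bit r ≤ bit p + bit q
bit-union {r = false} _ = z≤n
bit-union {p} {q} {true} cov with cov refl
... | inj₁ refl = s≤s z≤n
... | inj₂ refl = m≤n+m 1 (bit p)

cnt-union : ∀ P Q R n → (∀ i → i < n → R ∋ i → P ∋ i ⊎ Q ∋ i) → cnt R n ≤ cnt P n + cnt Q n
cnt-union P Q R zero    cov = z≤n
cnt-union P Q R (suc n) cov = begin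
  bit (R 0) + cnt (1 ▸ R) n                                    ≤⟨ +-mono-≤ (bit-union (cov 0 z<s))
    (cnt-union (1 ▸ P) (1 ▸ Q) (1 ▸ R) n (λ i i<n → cov (suc i) (s<s i<n))) ⟩
  bit (P 0) + bit (Q 0) + (cnt (1 ▸ P) n + cnt (1 ▸ Q) n)      ≡⟨ interchange (bit (P 0)) (bit (Q 0)) _ _ ⟩
  bit (P 0) + cnt (1 ▸ P) n + (bit (Q 0) + cnt (1 ▸ Q) n)      ∎
  where open ≤-Reasoning

mirror : ℕ → Pred → Pred
mirror n P i = P (n ∸ i)

cnt-mirror : ∀ P n → cnt (mirror n P) (suc n) ≡ cnt P (suc n)
cnt-mirror P zero    = refl
cnt-mirror P (suc n) = begin
  bit (P (suc n)) + cnt (mirror n P) (suc n)   ≡⟨ cong (bit (P (suc n)) +_) (cnt-mirror P n) ⟩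
  bit (P (suc n)) + cnt P (suc n)              ≡⟨ +-comm (bit (P (suc n))) _ ⟩
  cnt P (suc n) + bit (P (suc n))              ≡⟨ cnt-last P (suc n) ⟨
  cnt P (suc (suc n))                          ∎
  where open ≡-Reasoning

-- The intervals [0, e] and [e, 2e] overlap in e alone, hence the extra 1.
cnt-double : ∀ C e → C ∋ e → cnt C (suc e) + cnt (e ▸ C) (suc e) ≡ suc (cnt C (suc (e + e)))
cnt-double C e Ce = begin
  cnt C (suc e) + cnt (e ▸ C) (suc e)    ≡⟨ cong (_+ cnt (e ▸ C) (suc e)) (cnt-last-true C e Ce) ⟩
  suc (cnt C e + cnt (e ▸ C) (suc e))    ≡⟨ cong suc (cnt-splitAt C e (suc e) (+-suc e e)) ⟨
  suc (cnt C (suc (e + e)))              ∎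
  where open ≡-Reasoning

everything : Pred
everything _ = true

-- If x is not in A + A, at most one of i and x − i lies in A.
half-sparse : ∀ A x → (∀ i j → i + j ≡ x → A ∋ i → A ∋ j → ⊥) → 2 * cnt A (suc x) ≤ suc x
half-sparse A x avoids = begin
  2 * cnt A (suc x)                              ≡⟨ cong (cnt A (suc x) +_) (trans (+-identityʳ _) (sym (cnt-mirror A x))) ⟩
  cnt A (suc x) + cnt (mirror x A) (suc x)       ≤⟨ cnt-disjoint A (mirror x A) everything (suc x) (λ _ _ _ → refl) (λ _ _ _ → refl)
                                                      (λ i i≤x → avoids i (x ∸ i) (m+[n∸m]≡n (s≤s⁻¹ i≤x))) ⟩
  cnt everything (suc x)                         ≡⟨ cnt-full everything (suc x) (λ _ _ → refl) ⟩
  suc x                                          ∎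
  where open ≤-Reasoning

firstFalse : ∀ P n → ∃[ t ] (t ≤ n × (∀ i → i < t → P ∋ i) × (t ≡ n ⊎ P t ≡ false))
firstFalse P zero = 0 , z≤n , (λ _ ()) , inj₁ refl
firstFalse P (suc n) with P 0 in P0
... | false = 0 , z≤n , (λ _ ()) , inj₂ P0
... | true with firstFalse (1 ▸ P) n
... | t , t≤n , all , end = suc t , s≤s t≤n , all′ , map (cong suc) (λ e → e) end
  where
  all′ : ∀ i → i < suc t → P ∋ i
  all′ zero    _         = P0
  all′ (suc i) (s≤s i<t) = all i i<t

lastFalse : ∀ P n → ∃[ s ] (s ≤ n × (∀ x → s ≤ x → x < n → P ∋ x) × (s ≡ 0 ⊎ ∃[ x ] (s ≡ suc x × P x ≡ false)))
lastFalse P zero = 0 , z≤n , (λ _ _ ()) , inj₁ refl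
lastFalse P (suc n) with P n in Pn
... | false = suc n , ≤-refl , (λ x s≤x x<s → ⊥-elim (<⇒≱ x<s s≤x)) , inj₂ (n , refl , Pn)
... | true with lastFalse P n
... | s , s≤n , all , start = s , m≤n⇒m≤1+n s≤n , all′ , start
  where
  all′ : ∀ x → s ≤ x → x < suc n → P ∋ x
  all′ x s≤x x<1+n with m≤n⇒m<n∨m≡n (s≤s⁻¹ x<1+n)
  ... | inj₁ x<n  = all x s≤x x<n
  ... | inj₂ refl = Pn

search : ∀ P n → (∃[ i ] (i < n × P ∋ i)) ⊎ (∀ i → i < n → P i ≡ false)
search P zero = inj₂ λ _ ()
search P (suc n) with P n in Pn
... | true = inj₁ (n , ≤-refl , Pn)
... | false with search P n
... | inj₁ (i , i<n , Pi) = inj₁ (i , m≤n⇒m≤1+n i<n , Pi)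
... | inj₂ none = inj₂ none′
  where
  none′ : ∀ i → i < suc n → P i ≡ false
  none′ i i<1+n with m≤n⇒m<n∨m≡n (s≤s⁻¹ i<1+n)
  ... | inj₁ i<n  = none i i<n
  ... | inj₂ refl = Pn

firstTrue : ∀ P n → P ∋ n → ∃[ t ] (t ≤ n × P ∋ t × (∀ i → i < t → P i ≡ false))
firstTrue P n Pn with P 0 in P0
... | true = 0 , z≤n , P0 , λ _ ()
firstTrue P zero    Pn | false = ⊥-elim (true≢false Pn P0)
firstTrue P (suc n) Pn | false with firstTrue (1 ▸ P) n Pn
... | t , t≤n , Pt , none = suc t , s≤s t≤n , Pt , none′
  where
  none′ : ∀ i → i < suc t → P i ≡ false
  none′ zero    _         = P0
  none′ (suc i) (s≤s i<t) = none i i<t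

-- Sets filling more than half of their range

-- E is only required to contain the sumset, so that it can be enlarged or cut down at will.
Sums : Pred → ℕ → Pred → ℕ → Pred → Set
Sums X m Y n E = ∀ i j → i ≤ m → j ≤ n → X ∋ i → Y ∋ j → E ∋ i + j

-- The sums i + 0 with i < m lie below m and the sums m + j do not; only one copy of m is given up.
cnt-sum-ends : ∀ X m Y n E → Sums X m Y n E → X ∋ m → Y ∋ 0 →
               cnt X (suc m) + cnt Y (suc n) ≤ suc (cnt E (suc (m + n)))
cnt-sum-ends X m Y n E sums Xm Y0 = begin
  cnt X (suc m) + cnt Y (suc n)               ≡⟨ cong (_+ cnt Y (suc n)) (cnt-last-true X m Xm) ⟩
  suc (cnt X m + cnt Y (suc n))               ≤⟨ s≤s (+-mono-≤
    (cnt-mono X E m (λ i i<m Xi → subst (E ∋_) (+-identityʳ i) (sums i 0 (<⇒≤ i<m) z≤n Xi Y0)))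
    (cnt-mono Y (m ▸ E) (suc n) (λ j j≤n → sums m j ≤-refl (s≤s⁻¹ j≤n) Xm))) ⟩
  suc (cnt E m + cnt (m ▸ E) (suc n))         ≡⟨ cong suc (cnt-split E m (suc n)) ⟨
  suc (cnt E (m + suc n))                     ≡⟨ cong (λ z → suc (cnt E z)) (+-suc m n) ⟩
  suc (cnt E (suc (m + n)))                   ∎
  where open ≤-Reasoning

cnt-sum-top : ∀ X m Y n E → Sums X m Y n E → X ∋ m → ∃[ j ] (j ≤ n × Y ∋ j) →
              cnt X (suc m) + cnt Y (suc n) ≤ suc (cnt E (suc (m + n)))
cnt-sum-top X m Y n E sums Xm ex with Y 0 in Y0
cnt-sum-top X m Y n E sums Xm ex | true with cnt-sum-ends X m Y n E sums Xm Y0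
... | le rewrite Y0 = le
cnt-sum-top X m Y n       E sums Xm (zero , _ , Yj)            | false = ⊥-elim (true≢false Yj Y0)
cnt-sum-top X m Y (suc n) E sums Xm (suc j , s≤s j≤n , Yj) | false = begin
  cnt X (suc m) + cnt (1 ▸ Y) (suc n)      ≤⟨ cnt-sum-top X m (1 ▸ Y) n (1 ▸ E)
    (λ i j i≤m j≤n Xi Yj → subst (E ∋_) (+-suc i j) (sums i (suc j) i≤m (s≤s j≤n) Xi Yj)) Xm (j , j≤n , Yj) ⟩
  suc (cnt (1 ▸ E) (suc (m + n)))          ≤⟨ s≤s (cnt-shift E 1 (suc (m + n)) (≤-reflexive (cong suc (sym (+-suc m n))))) ⟩
  suc (cnt E (suc (m + suc n)))            ∎
  where open ≤-Reasoning

-- The range is trimmed until `cnt-sum-ends` applies: here from the top of `X`, in `cnt-sum-top`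
-- from the bottom of `Y`, where `E` is shifted along. The witnesses stop the trimming.
cnt-sum : ∀ X m Y n E → Sums X m Y n E → ∃[ i ] (i ≤ m × X ∋ i) → ∃[ j ] (j ≤ n × Y ∋ j) →
          cnt X (suc m) + cnt Y (suc n) ≤ suc (cnt E (suc (m + n)))
cnt-sum X m Y n E sums exX exY with X m in Xm
cnt-sum X m Y n E sums exX exY | true = cnt-sum-top X m Y n E sums Xm exY
cnt-sum X zero    Y n E sums (.0 , z≤n , Xi) exY | false = ⊥-elim (true≢false Xi Xm)
cnt-sum X (suc m) Y n E sums (i , i≤1+m , Xi) exY | false = begin
  cnt X (suc (suc m)) + cnt Y (suc n)      ≡⟨ cong (_+ cnt Y (suc n)) (cnt-last-false X (suc m) Xm) ⟩
  cnt X (suc m) + cnt Y (suc n)            ≤⟨ cnt-sum X m Y n E (λ i j i≤m → sums i j (m≤n⇒m≤1+n i≤m)) (i , i≤m , Xi) exY ⟩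
  suc (cnt E (suc (m + n)))                ≤⟨ s≤s (cnt-grow E (n≤1+n (suc (m + n)))) ⟩
  suc (cnt E (suc (suc m + n)))            ∎
  where
  open ≤-Reasoning
  i≤m : i ≤ m
  i≤m with m≤n⇒m<n∨m≡n i≤1+m
  ... | inj₁ i<1+m = s≤s⁻¹ i<1+m
  ... | inj₂ refl  = ⊥-elim (true≢false Xi Xm)

-- That is, e ≤ 2|A| - 3: the range in which |A| + e is the smaller of the two values in Freiman's
-- bound.
Dense : Pred → ℕ → Set
Dense A e = e + 3 ≤ 2 * cnt A (suc e)

sparse-below : ∀ A C e x → Sums A e A e C → x ≤ e → C x ≡ false → 2 * cnt A (suc x) ≤ suc x
sparse-below A C e x sums x≤e Cx = half-sparse A x λ i j i+j≡x Ai Aj →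
  true≢false (subst (C ∋_) i+j≡x
    (sums i j (≤-trans (m+n≤o⇒m≤o i (≤-reflexive i+j≡x)) x≤e) (≤-trans (m+n≤o⇒n≤o i (≤-reflexive i+j≡x)) x≤e) Ai Aj)) Cx

-- The pairing z ↦ e + y - z preserves [y, e], so a translation by y reduces this to `half-sparse`.
sparse-above : ∀ A C e y r → Sums A e A e C → y + r ≡ e → C (e + y) ≡ false → 2 * cnt (y ▸ A) (suc r) ≤ suc r
sparse-above A C e y r sums refl Cy = half-sparse (y ▸ A) r λ i j i+j≡r Ai Aj →
  true≢false (subst (C ∋_) (eq i j i+j≡r)
    (sums (y + i) (y + j) (+-monoʳ-≤ y (m+n≤o⇒m≤o i (≤-reflexive i+j≡r))) (+-monoʳ-≤ y (m+n≤o⇒n≤o i (≤-reflexive i+j≡r))) Ai Aj)) Cy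
  where
  eq : ∀ i j → i + j ≡ r → y + i + (y + j) ≡ y + r + y
  eq i j refl = solve (y ∷ i ∷ j ∷ [])

-- If both were missing, `A` would fill at most half of [0, x] and half of [x, e], giving 2|A| ≤ e +
-- 2.
covered : ∀ A C e → Sums A e A e C → Dense A e → ∀ x → x ≤ e → C ∋ x ⊎ C ∋ e + x
covered A C e sums dense x x≤e with C x in Cx | C (e + x) in Cex
... | true  | _    = inj₁ refl
... | false | true = inj₂ refl
... | false | false with m≤n⇒∃[o]m+o≡n x≤e
... | r , refl = ⊥-elim (1+n≰n (arith x r (cnt A (suc x)) (cnt (x ▸ A) (suc r)) (cnt A (suc (x + r)))
                   (sparse-below A C (x + r) x sums x≤e Cx) (sparse-above A C (x + r) x r sums refl Cex) dense k≤))
  where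
  arith : ∀ x r a b k → 2 * a ≤ suc x → 2 * b ≤ suc r → x + r + 3 ≤ 2 * k → k ≤ a + b → 1 ≤ 0
  arith x r a b k p q d h = lin 1 0 0 (+-mono-≤ p (+-mono-≤ q (+-mono-≤ d (+-mono-≤ h h)))) (solve (x ∷ r ∷ a ∷ b ∷ k ∷ []))
  k≤ : cnt A (suc (x + r)) ≤ cnt A (suc x) + cnt (x ▸ A) (suc r)
  k≤ = begin
    cnt A (suc (x + r))                   ≡⟨ cong (cnt A) (+-suc x r) ⟨
    cnt A (x + suc r)                     ≡⟨ cnt-split A x (suc r) ⟩
    cnt A x + cnt (x ▸ A) (suc r)         ≤⟨ +-monoˡ-≤ _ (cnt-grow A (n≤1+n x)) ⟩
    cnt A (suc x) + cnt (x ▸ A) (suc r)   ∎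
    where open ≤-Reasoning

-- s − 1 is the last point of [0, e] missing from A + A, and e + s + t is the next missing point
-- above e + s; half of the points before s and half of those from s + t on are missing from A.
record Window (A C : Pred) (e : ℕ) : Set where
  field
    s t r     : ℕ
    span      : s + (t + r) ≡ suc e
    low-full  : ∀ x → s ≤ x → x ≤ e → C ∋ x
    high-full : ∀ i → i < t → C ∋ e + (s + i)
    long      : 2 * cnt A (suc e) ≤ t + suc e

sparse-before : ∀ A C e s → Sums A e A e C → s ≤ suc e → s ≡ 0 ⊎ ∃[ x ] (s ≡ suc x × C x ≡ false) → 2 * cnt A s ≤ s
sparse-before A C e _ sums s≤ (inj₁ refl) = z≤n
sparse-before A C e _ sums s≤ (inj₂ (x , refl , Cx)) = sparse-below A C e x sums (s≤s⁻¹ s≤) Cx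

sparse-after : ∀ A C e y r → Sums A e A e C → y + r ≡ suc e → r ≡ 0 ⊎ C (e + y) ≡ false → 2 * cnt (y ▸ A) r ≤ r
sparse-after A C e y zero    sums eq _           = z≤n
sparse-after A C e y (suc r) sums eq (inj₂ Cey) = sparse-above A C e y r sums (suc-injective (trans (sym (+-suc y r)) eq)) Cey

-- Off the window `A` fills at most half of each side, and inside it at most every point, so 2|A| ≤
-- s + 2t + r, where s + t + r = e + 1.
window : ∀ A C e → Sums A e A e C → Window A C e
window A C e sums with lastFalse C (suc e)
... | s , s≤ , low , start with m≤n⇒∃[o]m+o≡n s≤
... | q , s+q≡ with firstFalse (s ▸ (e ▸ C)) q
... | t , t≤q , high , end with m≤n⇒∃[o]m+o≡n t≤q
... | r , refl = record
  { s = s ; t = t ; r = r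
  ; span      = s+q≡
  ; low-full  = λ x s≤x x≤e → low x s≤x (s≤s x≤e)
  ; high-full = high
  ; long      = long
  }
  where
  above : 2 * cnt ((s + t) ▸ A) r ≤ r
  above = sparse-after A C e (s + t) r sums (trans (+-assoc s t r) s+q≡)
            (map₁ (λ t≡ → +-cancelˡ-≡ t r 0 (trans (sym t≡) (sym (+-identityʳ t)))) end)
  arith : ∀ s t r a b c {k e} → s + t + r ≡ e → k ≡ a + b + c → 2 * a ≤ s → b ≤ t → 2 * c ≤ r → 2 * k ≤ t + e
  arith s t r a b c refl refl p q h = lin _ _ 0 (+-mono-≤ p (+-mono-≤ q (+-mono-≤ q h))) (solve (s ∷ t ∷ r ∷ a ∷ b ∷ c ∷ []))
  long : 2 * cnt A (suc e) ≤ t + suc e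
  long = arith s t r (cnt A s) (cnt (s ▸ A) t) (cnt ((s + t) ▸ A) r) (trans (+-assoc s t r) s+q≡)
    (trans (cnt-splitAt A (s + t) r (trans (+-assoc s t r) s+q≡)) (cong (_+ cnt ((s + t) ▸ A) r) (cnt-split A s t)))
    (sparse-before A C e s sums s≤ start) (cnt-≤ (s ▸ A) t) above

-- Let W be the first m points of the window. As [0, e] is covered by `C` and its shift by -e, |C| ≥
-- e + |G|, where `G` contains `A` and all of W. `E` contains `A` below s + m and the translate by γ
-- of `A` from s on, which starts at s + γ ≥ s + m, so that A ∩ W is counted twice. The gains m - |A
-- ∩ W| and |A ∩ W| add up to m.
dense-pair-count : ∀ A C e → A ∋ 0 → A ∋ e → Sums A e A e C → Dense A e → (w : Window A C e) → let open Window w in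
  ∀ E γ m δ → m + δ ≡ γ → m ≤ t → (∀ a → a ≤ e → A ∋ a → E ∋ a) → (∀ a → a ≤ e → A ∋ a → E ∋ γ + a) →
  e + 2 * cnt A (suc e) + m ≤ cnt C (suc (e + e)) + cnt E (suc (e + γ))
dense-pair-count A C e A0 Ae sums dense w E _ m δ refl m≤t E₀ Eγ = begin
  e + 2 * cnt A (suc e) + m                                        ≤⟨
    arith e m (cnt A s) (cnt (s ▸ A) m) (cnt (m ▸ (s ▸ A)) r′) (cnt A (suc e)) (cnt (s ▸ A) q) (cnt G (suc e))
          (cnt C (suc (e + e))) (cnt E (suc (e + (m + δ)))) A-split q-split G-count C-count E-count ⟩
  cnt C (suc (e + e)) + cnt E (suc (e + (m + δ)))                  ∎
  where
  open ≤-Reasoning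
  open Window w
  q : ℕ
  q = t + r
  r′ : ℕ
  r′ = proj₁ (m≤n⇒∃[o]m+o≡n (≤-trans m≤t (m≤m+n t r)))
  m+r′≡q : m + r′ ≡ q
  m+r′≡q = proj₂ (m≤n⇒∃[o]m+o≡n (≤-trans m≤t (m≤m+n t r)))
  in-range : ∀ {i} → i < q → s + i ≤ e
  in-range i<q = s≤s⁻¹ (≤-trans (+-monoʳ-< s i<q) (≤-reflexive span))
  G : Pred
  G = C ∩ (e ▸ C)
  A⊆G : ∀ x → x ≤ e → A ∋ x → G ∋ x
  A⊆G x x≤e Ax = ∩-intro C (e ▸ C) (sums 0 x z≤n x≤e A0 Ax) (sums e x ≤-refl x≤e Ae Ax)
  A-split : cnt A (suc e) ≡ cnt A s + (cnt (s ▸ A) m + cnt (m ▸ (s ▸ A)) r′)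
  A-split = trans (cnt-splitAt A s q span) (cong (cnt A s +_) (cnt-splitAt (s ▸ A) m r′ m+r′≡q))
  q-split : cnt (s ▸ A) q ≡ cnt (s ▸ A) m + cnt (m ▸ (s ▸ A)) r′
  q-split = cnt-splitAt (s ▸ A) m r′ m+r′≡q
  C-count : e + cnt G (suc e) ≤ cnt C (suc (e + e))
  C-count = s≤s⁻¹ (begin
    suc e + cnt G (suc e)                          ≤⟨ cnt-cover G C (e ▸ C) (suc e)
      (λ x x≤e → covered A C e sums dense x (s≤s⁻¹ x≤e)) (λ x _ m → proj₁ (∧-elim m)) (λ x _ m → proj₂ (∧-elim {C x} m)) ⟩
    cnt C (suc e) + cnt (e ▸ C) (suc e)            ≡⟨ cnt-double C e (sums 0 e z≤n ≤-refl A0 Ae) ⟩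
    suc (cnt C (suc (e + e)))                      ∎)
  G-count : cnt A s + (m + cnt (m ▸ (s ▸ A)) r′) ≤ cnt G (suc e)
  G-count = begin
    cnt A s + (m + cnt (m ▸ (s ▸ A)) r′)                            ≤⟨ +-mono-≤
      (cnt-mono A G s (λ x x<s → A⊆G x (s≤s⁻¹ (≤-trans x<s (≤-trans (m≤m+n s q) (≤-reflexive span))))))
      (+-mono-≤ (≤-reflexive (sym (cnt-full (s ▸ G) m (λ i i<m → ∩-intro C (e ▸ C)
                   (low-full (s + i) (m≤m+n s i) (in-range (<-≤-trans i<m (≤-trans m≤t (m≤m+n t r)))))
                   (high-full i (<-≤-trans i<m m≤t))))))
                (cnt-mono (m ▸ (s ▸ A)) (m ▸ (s ▸ G)) r′
                   (λ i i<r′ → A⊆G (s + (m + i)) (in-range (subst (m + i <_) m+r′≡q (+-monoʳ-< m i<r′)))))) ⟩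
    cnt G s + (cnt (s ▸ G) m + cnt (m ▸ (s ▸ G)) r′)                ≡⟨ cong (cnt G s +_) (cnt-split (s ▸ G) m r′) ⟨
    cnt G s + cnt (s ▸ G) (m + r′)                                  ≡⟨ cnt-split G s (m + r′) ⟨
    cnt G (s + (m + r′))                                            ≡⟨ cong (λ z → cnt G (s + z)) m+r′≡q ⟩
    cnt G (s + q)                                                   ≡⟨ cong (cnt G) span ⟩
    cnt G (suc e)                                                   ∎
  E-length : ∀ s q m δ e → s + q ≡ suc e → s + (m + (δ + q)) ≡ suc (e + (m + δ))
  E-length s q m δ e eq = trans (lhs s q m δ) (cong (_+ (m + δ)) eq)
    where
    lhs : ∀ s q m δ → s + (m + (δ + q)) ≡ s + q + (m + δ)
    lhs s q m δ = solve (s ∷ q ∷ m ∷ δ ∷ [])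
  shuffle : ∀ s m δ i → m + δ + (s + i) ≡ s + (m + (δ + i))
  shuffle s m δ i = solve (s ∷ m ∷ δ ∷ i ∷ [])
  E-count : cnt A s + (cnt (s ▸ A) m + cnt (s ▸ A) q) ≤ cnt E (suc (e + (m + δ)))
  E-count = begin
    cnt A s + (cnt (s ▸ A) m + cnt (s ▸ A) q)                       ≤⟨ +-mono-≤
      (cnt-mono A E s (λ x x<s → E₀ x (s≤s⁻¹ (≤-trans x<s (≤-trans (m≤m+n s q) (≤-reflexive span))))))
      (+-mono-≤ (cnt-mono (s ▸ A) (s ▸ E) m (λ i i<m → E₀ (s + i) (in-range (<-≤-trans i<m (≤-trans m≤t (m≤m+n t r))))))
                (≤-trans (cnt-mono (s ▸ A) (δ ▸ (m ▸ (s ▸ E))) q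
                            (λ i i<q Ai → subst (E ∋_) (shuffle s m δ i) (Eγ (s + i) (in-range i<q) Ai)))
                         (cnt-shift (m ▸ (s ▸ E)) δ q ≤-refl))) ⟩
    cnt E s + (cnt (s ▸ E) m + cnt (m ▸ (s ▸ E)) (δ + q))           ≡⟨ cong (cnt E s +_) (cnt-split (s ▸ E) m (δ + q)) ⟨
    cnt E s + cnt (s ▸ E) (m + (δ + q))                             ≡⟨ cnt-split E s _ ⟨
    cnt E (s + (m + (δ + q)))                                       ≡⟨ cong (cnt E) (E-length s q m δ e span) ⟩
    cnt E (suc (e + (m + δ)))                                       ∎
  arith : ∀ e m a b c k aq g x y → k ≡ a + (b + c) → aq ≡ b + c → a + (m + c) ≤ g → e + g ≤ x → a + (b + aq) ≤ y →
          e + 2 * k + m ≤ x + y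
  arith e m a b c _ _ g x y refl refl p q h =
    lin _ _ 0 (+-mono-≤ p (+-mono-≤ q h)) (solve (e ∷ m ∷ a ∷ b ∷ c ∷ g ∷ x ∷ y ∷ []))

-- Take m to be the smaller of γ and the length t of the window. If the window is shorter, `long`
-- gives t ≥ 2|A| - e - 1, which turns e + 2|A| + t into 4|A| - 1.
dense-pair : ∀ A C E e γ → A ∋ 0 → A ∋ e → Sums A e A e C → Dense A e →
  (∀ a → a ≤ e → A ∋ a → E ∋ a) → (∀ a → a ≤ e → A ∋ a → E ∋ γ + a) →
  e + 2 * cnt A (suc e) + γ ≤ cnt C (suc (e + e)) + cnt E (suc (e + γ)) ⊎
  4 * cnt A (suc e) ≤ suc (cnt C (suc (e + e)) + cnt E (suc (e + γ)))
dense-pair A C E e γ A0 Ae sums dense E₀ Eγ with window A C e sums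
... | w with ≤-total γ (Window.t w)
... | inj₁ γ≤t = inj₁ (dense-pair-count A C e A0 Ae sums dense w E γ γ 0 (+-identityʳ γ) γ≤t E₀ Eγ)
... | inj₂ t≤γ with m≤n⇒∃[o]m+o≡n t≤γ
... | δ , t+δ≡γ = inj₂ (arith e (Window.t w) (cnt A (suc e)) _ (dense-pair-count A C e A0 Ae sums dense w E γ (Window.t w) δ t+δ≡γ ≤-refl E₀ Eγ) (Window.long w))
  where
  arith : ∀ e t k x → e + 2 * k + t ≤ x → 2 * k ≤ t + suc e → 4 * k ≤ suc x
  arith e t k x p q = lin _ _ 0 (+-mono-≤ p q) (solve (e ∷ t ∷ k ∷ x ∷ []))

-- With s = e + 1 the window would be empty, and `long` would contradict density.
window-start : ∀ A C e → Dense A e → (w : Window A C e) → Window.s w ≤ e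
window-start A C e dense w with Window.s w ≤? e
... | yes s≤e = s≤e
... | no s≰e = ⊥-elim (1+n≰n (arith s t e (cnt A (suc e)) (≰⇒> s≰e)
                 (≤-trans (+-monoʳ-≤ s (m≤m+n t r)) (≤-reflexive span)) dense long))
  where
  open Window w
  arith : ∀ s t e k → suc e ≤ s → s + t ≤ suc e → e + 3 ≤ 2 * k → 2 * k ≤ t + suc e → 1 ≤ 0
  arith s t e k p q h g = lin 1 0 1 (+-mono-≤ p (+-mono-≤ q (+-mono-≤ h g))) (solve (s ∷ t ∷ e ∷ k ∷ []))

-- Cut the range at e, e + s and e + s + m. `C` is full on [s, e); by `covered`, [0, s) and its
-- shift by e contribute s plus the number of elements of `A` below s; the window contributes m; and
-- the points e + γ + a with a ≥ s lie at or beyond e + s + m.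
dense-extend-count : ∀ A C e → A ∋ 0 → A ∋ e → Sums A e A e C → Dense A e → (w : Window A C e) → let open Window w in
  ∀ γ m δ → m + δ ≡ γ → m ≤ t → (∀ a → a ≤ e → A ∋ a → C ∋ e + γ + a) →
  e + cnt A (suc e) + m ≤ cnt C (suc (e + (e + γ)))
dense-extend-count A C e A0 Ae sums dense w _ m δ refl m≤t Cγ = begin
  e + cnt A (suc e) + m                                            ≤⟨
    arith s q′ e m (cnt A s) (cnt (s ▸ A) q) (cnt A (suc e)) (cnt C s) (cnt (s ▸ (e ▸ C)) m) (cnt (m ▸ (s ▸ (e ▸ C))) (δ + q))
          (cnt (e ▸ C) s) (cnt C e) s+q′≡e A-split C-split cover full top ⟩
  cnt C e + (cnt (e ▸ C) s + (cnt (s ▸ (e ▸ C)) m + cnt (m ▸ (s ▸ (e ▸ C))) (δ + q)))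
    ≡⟨ cong (λ z → cnt C e + (cnt (e ▸ C) s + z)) (cnt-split (s ▸ (e ▸ C)) m (δ + q)) ⟨
  cnt C e + (cnt (e ▸ C) s + cnt (s ▸ (e ▸ C)) (m + (δ + q)))      ≡⟨ cong (cnt C e +_) (cnt-split (e ▸ C) s _) ⟨
  cnt C e + cnt (e ▸ C) (s + (m + (δ + q)))                        ≡⟨ cnt-split C e _ ⟨
  cnt C (e + (s + (m + (δ + q))))                                  ≡⟨ cong (cnt C) (C-length s q m δ e span) ⟩
  cnt C (suc (e + (e + (m + δ))))                                  ∎
  where
  open ≤-Reasoning
  open Window w
  q : ℕ
  q = t + r
  q′ : ℕ
  q′ = proj₁ (m≤n⇒∃[o]m+o≡n (window-start A C e dense w))
  s+q′≡e : s + q′ ≡ e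
  s+q′≡e = proj₂ (m≤n⇒∃[o]m+o≡n (window-start A C e dense w))
  in-range : ∀ {i} → i < q → s + i ≤ e
  in-range i<q = s≤s⁻¹ (≤-trans (+-monoʳ-< s i<q) (≤-reflexive span))
  C-length : ∀ s q m δ e → s + q ≡ suc e → e + (s + (m + (δ + q))) ≡ suc (e + (e + (m + δ)))
  C-length s q m δ e eq = trans (lhs s q m δ e) (trans (cong (λ z → e + (z + (m + δ))) eq) (+-suc e _))
    where
    lhs : ∀ s q m δ e → e + (s + (m + (δ + q))) ≡ e + (s + q + (m + δ))
    lhs s q m δ e = solve (s ∷ q ∷ m ∷ δ ∷ e ∷ [])
  shuffle : ∀ e s m δ i → e + (m + δ) + (s + i) ≡ e + (s + (m + (δ + i)))
  shuffle e s m δ i = solve (e ∷ s ∷ m ∷ δ ∷ i ∷ [])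
  A-split : cnt A (suc e) ≡ cnt A s + cnt (s ▸ A) q
  A-split = cnt-splitAt A s q span
  C-split : cnt C e ≡ cnt C s + q′
  C-split = trans (cong (cnt C) (sym s+q′≡e)) (trans (cnt-split C s q′) (cong (cnt C s +_) (cnt-full (s ▸ C) q′
    (λ i i<q′ → low-full (s + i) (m≤m+n s i) (≤-trans (+-monoʳ-≤ s (<⇒≤ i<q′)) (≤-reflexive s+q′≡e))))))
  s-range : ∀ {x} → x < s → x ≤ e
  s-range x<s = ≤-trans (<⇒≤ x<s) (window-start A C e dense w)
  cover : s + cnt A s ≤ cnt C s + cnt (e ▸ C) s
  cover = cnt-cover A C (e ▸ C) s (λ x x<s → covered A C e sums dense x (s-range x<s))
    (λ x x<s Ax → sums 0 x z≤n (s-range x<s) A0 Ax) (λ x x<s Ax → sums e x ≤-refl (s-range x<s) Ae Ax)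
  full : cnt (s ▸ (e ▸ C)) m ≡ m
  full = cnt-full (s ▸ (e ▸ C)) m (λ i i<m → high-full i (<-≤-trans i<m m≤t))
  top : cnt (s ▸ A) q ≤ cnt (m ▸ (s ▸ (e ▸ C))) (δ + q)
  top = ≤-trans (cnt-mono (s ▸ A) (δ ▸ (m ▸ (s ▸ (e ▸ C)))) q
                   (λ i i<q Ai → subst (C ∋_) (shuffle e s m δ i) (Cγ (s + i) (in-range i<q) Ai)))
                (cnt-shift (m ▸ (s ▸ (e ▸ C))) δ q ≤-refl)
  arith : ∀ s q′ e m a b k x f y z c → s + q′ ≡ e → k ≡ a + b → c ≡ x + q′ → s + a ≤ x + z → f ≡ m → b ≤ y →
          e + k + m ≤ c + (z + (f + y))
  arith s q′ _ m a b _ x _ y z _ refl refl refl p refl h =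
    lin _ _ 0 (+-mono-≤ p h) (solve (s ∷ q′ ∷ m ∷ a ∷ b ∷ x ∷ y ∷ z ∷ []))

dense-extend : ∀ A C e γ → A ∋ 0 → A ∋ e → Sums A e A e C → Dense A e → (∀ a → a ≤ e → A ∋ a → C ∋ e + γ + a) →
  e + cnt A (suc e) + γ ≤ cnt C (suc (e + (e + γ))) ⊎ 3 * cnt A (suc e) ≤ suc (cnt C (suc (e + (e + γ))))
dense-extend A C e γ A0 Ae sums dense Cγ with window A C e sums
... | w with ≤-total γ (Window.t w)
... | inj₁ γ≤t = inj₁ (dense-extend-count A C e A0 Ae sums dense w γ γ 0 (+-identityʳ γ) γ≤t Cγ)
... | inj₂ t≤γ with m≤n⇒∃[o]m+o≡n t≤γ
... | δ , t+δ≡γ = inj₂ (arith e (Window.t w) (cnt A (suc e)) _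
                    (dense-extend-count A C e A0 Ae sums dense w γ (Window.t w) δ t+δ≡γ ≤-refl Cγ) (Window.long w))
  where
  arith : ∀ e t k x → e + k + t ≤ x → 2 * k ≤ t + suc e → 3 * k ≤ suc x
  arith e t k x p q = lin _ _ 0 (+-mono-≤ p q) (solve (e ∷ t ∷ k ∷ x ∷ []))

-- Freiman's theorem: removing the last element

multiple nonmultiple : ℕ → Pred
multiple g x = does (g ∣? x)
nonmultiple g x = not (multiple g x)

multiple-intro : ∀ {g x} → g ∣ x → multiple g ∋ x
multiple-intro {g} {x} = dec-true (g ∣? x)

nonmultiple-intro : ∀ {g x} → ¬ g ∣ x → nonmultiple g ∋ x
nonmultiple-intro {g} {x} g∤x = cong not (dec-false (g ∣? x) g∤x)

cnt-classes : ∀ g P n → cnt (P ∩ multiple g) n + cnt (P ∩ nonmultiple g) n ≤ cnt P n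
cnt-classes g P n = cnt-disjoint (P ∩ multiple g) (P ∩ nonmultiple g) P n
  (λ _ _ m → proj₁ (∧-elim m)) (λ _ _ m → proj₁ (∧-elim m))
  (λ i _ m m̸ → true≢false (proj₂ (∧-elim {P i} m̸)) (cong not (proj₂ (∧-elim {P i} m))))

∣m+n∣n⇒∣m : ∀ {d m n} → d ∣ m + n → d ∣ n → d ∣ m
∣m+n∣n⇒∣m {d} {m} {n} d∣m+n = ∣m+n∣m⇒∣n (subst (d ∣_) (+-comm m n) d∣m+n)

gcdOf : Pred → ℕ → ℕ
gcdOf A zero    = 0
gcdOf A (suc n) = if A n then gcd n (gcdOf A n) else gcdOf A n

gcdOf-∣ : ∀ A n a → a < n → A ∋ a → gcdOf A n ∣ a
gcdOf-∣ A (suc n) a a<1+n Aa with m≤n⇒m<n∨m≡n (s≤s⁻¹ a<1+n) | A n in An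
... | inj₁ a<n  | true  = ∣-trans (gcd[m,n]∣n n (gcdOf A n)) (gcdOf-∣ A n a a<n Aa)
... | inj₁ a<n  | false = gcdOf-∣ A n a a<n Aa
... | inj₂ refl | true  = gcd[m,n]∣m n (gcdOf A n)
... | inj₂ refl | false = ⊥-elim (true≢false Aa An)

gcdOf-greatest : ∀ A n h → (∀ a → a < n → A ∋ a → h ∣ a) → h ∣ gcdOf A n
gcdOf-greatest A zero    h all = h ∣0
gcdOf-greatest A (suc n) h all with A n in An
... | true  = gcd-greatest (all n ≤-refl An) (gcdOf-greatest A n h (λ a a<n → all a (m≤n⇒m≤1+n a<n)))
... | false = gcdOf-greatest A n h (λ a a<n → all a (m≤n⇒m≤1+n a<n))

Coprime : Pred → ℕ → Set
Coprime A ℓ = ∀ g → (∀ a → a ≤ ℓ → A ∋ a → g ∣ a) → g ≡ 1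

sumAt : Pred → ℕ → ℕ → Pred
sumAt A e z i = A i ∧ (A (z ∸ i) ∧ (does (i ≤? z) ∧ does (z ∸ i ≤? e)))

-- The sumset itself, where the rest works with supersets: to know that a sum is new, the set must
-- contain nothing else.
sumset : Pred → ℕ → Pred
sumset A e z with search (sumAt A e z) (suc e)
... | inj₁ _ = true
... | inj₂ _ = false

sumset-complete : ∀ A e → Sums A e A e (sumset A e)
sumset-complete A e i j i≤e j≤e Ai Aj with search (sumAt A e (i + j)) (suc e)
... | inj₁ _ = refl
... | inj₂ none = ⊥-elim (true≢false at (none i (s≤s i≤e)))
  where
  at : sumAt A e (i + j) ∋ i
  at rewrite Ai | m+n∸m≡n i j | Aj | dec-true (i ≤? i + j) (m≤m+n i j) | dec-true (j ≤? e) j≤e = refl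

sumset-sound : ∀ A e z → sumset A e ∋ z → ∃[ i ] ∃[ j ] (i ≤ e × j ≤ e × A ∋ i × A ∋ j × i + j ≡ z)
sumset-sound A e z eq with search (sumAt A e z) (suc e)
... | inj₁ (i , i<1+e , at) =
  let Ai , rest   = ∧-elim at
      Aj , rest′  = ∧-elim {A (z ∸ i)} rest
      i≤z , j≤e   = ∧-elim {does (i ≤? z)} rest′
  in i , z ∸ i , s≤s⁻¹ i<1+e , witness (z ∸ i ≤? e) j≤e , Ai , Aj , m+[n∸m]≡n (witness (i ≤? z) i≤z)

lastTrue : ∀ P n → P ∋ 0 → 1 ≤ n → ∃[ e ] ∃[ t ] (suc e + t ≡ n × P ∋ e × (∀ i → i < t → P (suc e + i) ≡ false))
lastTrue P (suc n) P0 _ with P n in Pn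
... | true = n , 0 , cong suc (+-identityʳ n) , Pn , λ _ ()
lastTrue P (suc zero)    P0 _ | false = ⊥-elim (true≢false P0 Pn)
lastTrue P (suc (suc n)) P0 _ | false with lastTrue P (suc n) P0 (s≤s z≤n)
... | e , t , refl , Pe , none = e , suc t , +-suc (suc e) t , Pe , none′
  where
  none′ : ∀ i → i < suc t → P (suc e + i) ≡ false
  none′ i i<1+t with m≤n⇒m<n∨m≡n (s≤s⁻¹ i<1+t)
  ... | inj₁ i<t  = none i i<t
  ... | inj₂ refl = Pn

-- With `suc u + t` in `A`, that point is the successor of u in `A`, at distance `suc t`.
Gap : Pred → ℕ → ℕ → Set
Gap A u t = ∀ i → i < t → A (suc u + i) ≡ false

cnt-gap : ∀ A u t → Gap A u t → A ∋ suc u + t → cnt A (suc (suc u + t)) ≡ suc (cnt A (suc u))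
cnt-gap A u t gap Av = begin
  cnt A (suc (suc u + t))                     ≡⟨ cnt-last-true A (suc u + t) Av ⟩
  suc (cnt A (suc u + t))                     ≡⟨ cong suc (cnt-split A (suc u) t) ⟩
  suc (cnt A (suc u) + cnt (suc u ▸ A) t)     ≡⟨ cong (λ z → suc (cnt A (suc u) + z)) (cnt-none (suc u ▸ A) t gap) ⟩
  suc (cnt A (suc u) + 0)                     ≡⟨ cong suc (+-identityʳ _) ⟩
  suc (cnt A (suc u))                         ∎
  where open ≡-Reasoning

gap-jump : ∀ A u t a → Gap A u t → a ≤ suc u + t → A ∋ a → a ≤ u ⊎ a ≡ suc u + t
gap-jump A u t a gap a≤v Aa with m≤n⇒m<n∨m≡n a≤v | a ≤? u
... | inj₂ a≡v | _       = inj₂ a≡v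
... | inj₁ _   | yes a≤u = inj₁ a≤u
... | inj₁ a<v | no a≰u with m≤n⇒∃[o]m+o≡n (≰⇒> a≰u)
... | i , refl = ⊥-elim (true≢false Aa (gap i (+-cancelˡ-< (suc u) i t a<v)))

Bound : Pred → Pred → ℕ → Set
Bound A C ℓ = cnt A (suc ℓ) + ℓ ≤ cnt C (suc (ℓ + ℓ)) ⊎ 3 * cnt A (suc ℓ) ≤ 3 + cnt C (suc (ℓ + ℓ))

Freiman : ℕ → Set
Freiman ℓ = ∀ A C → A ∋ 0 → A ∋ ℓ → Sums A ℓ A ℓ C → Coprime A ℓ → Bound A C ℓ

-- `C` and its shift by -ℓ cover [0, ℓ] and both contain `A`, so inclusion-exclusion applies; the
-- point ℓ is counted twice.
dense-bound : ∀ A C ℓ → A ∋ 0 → A ∋ ℓ → Sums A ℓ A ℓ C → Dense A ℓ → cnt A (suc ℓ) + ℓ ≤ cnt C (suc (ℓ + ℓ))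
dense-bound A C ℓ A0 Aℓ sums dense = s≤s⁻¹ (begin
  suc (cnt A (suc ℓ) + ℓ)                  ≡⟨ cong suc (+-comm (cnt A (suc ℓ)) ℓ) ⟩
  suc ℓ + cnt A (suc ℓ)                    ≤⟨ cnt-cover A C (ℓ ▸ C) (suc ℓ)
    (λ x x≤ℓ → covered A C ℓ sums dense x (s≤s⁻¹ x≤ℓ))
    (λ x x≤ℓ → sums 0 x z≤n (s≤s⁻¹ x≤ℓ) A0) (λ x x≤ℓ → sums ℓ x ≤-refl (s≤s⁻¹ x≤ℓ) Aℓ) ⟩
  cnt C (suc ℓ) + cnt (ℓ ▸ C) (suc ℓ)      ≡⟨ cnt-double C ℓ (sums 0 ℓ z≤n ≤-refl A0 Aℓ) ⟩
  suc (cnt C (suc (ℓ + ℓ)))                ∎)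
  where open ≤-Reasoning

-- Outside the dense range k + ℓ ≥ 3k - 3, so the first alternative implies the second.
nondense-bound : ∀ A C ℓ → 2 * cnt A (suc ℓ) ≤ ℓ + 3 → Bound A C ℓ → 3 * cnt A (suc ℓ) ≤ 3 + cnt C (suc (ℓ + ℓ))
nondense-bound A C ℓ h (inj₂ le) = le
nondense-bound A C ℓ h (inj₁ le) = arith (cnt A (suc ℓ)) ℓ _ h le
  where
  arith : ∀ k ℓ c → 2 * k ≤ ℓ + 3 → k + ℓ ≤ c → 3 * k ≤ 3 + c
  arith k ℓ c p q = lin _ _ 0 (+-mono-≤ p q) (solve (k ∷ ℓ ∷ c ∷ []))

module LastGap (A C : Pred) (e t : ℕ) (A0 : A ∋ 0) (Ae : A ∋ e) (Aℓ : A ∋ suc e + t)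
               (gap : Gap A e t) (sums : Sums A (suc e + t) A (suc e + t) C) where

  ℓ p : ℕ
  ℓ = suc e + t
  p = cnt A (suc e)

  e≤ℓ : e ≤ ℓ
  e≤ℓ = m≤n⇒m≤1+n (m≤m+n e t)

  sums′ : Sums A e A e C
  sums′ i j i≤e j≤e = sums i j (≤-trans i≤e e≤ℓ) (≤-trans j≤e e≤ℓ)

  sums-top : ∀ a → a ≤ e → A ∋ a → C ∋ ℓ + a
  sums-top a a≤e = sums ℓ a ≤-refl (≤-trans a≤e e≤ℓ) Aℓ

  count-top : suc (cnt C (suc (e + ℓ))) ≤ cnt C (suc (ℓ + ℓ))
  count-top = ≤-trans (s≤s (cnt-grow C (+-monoˡ-≤ ℓ (s≤s (m≤m+n e t)))))
                      (≤-reflexive (sym (cnt-last-true C (ℓ + ℓ) (sums ℓ ℓ ≤-refl ≤-refl Aℓ Aℓ))))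

  cnt-A : cnt A (suc ℓ) ≡ suc p
  cnt-A = cnt-gap A e t gap Aℓ

  -- Since |A| = p + 1 and ℓ + ℓ lies beyond e + ℓ, it is enough to find 3p - 1 sums up to e + ℓ.
  by-top : 3 * p ≤ suc (cnt C (suc (e + ℓ))) → Bound A C ℓ
  by-top h = inj₂ (arith p _ _ _ cnt-A h count-top)
    where
    arith : ∀ p k x y → k ≡ suc p → 3 * p ≤ suc x → suc x ≤ y → 3 * k ≤ 3 + y
    arith p _ x y refl h g = lin _ _ 0 (+-mono-≤ h g) (solve (p ∷ x ∷ y ∷ []))

  -- Apply `dense-extend` with γ the last gap: e + γ = ℓ, so the translate consists of sums with ℓ.
  -- Adding ℓ + ℓ turns its two alternatives into those of `Bound`.
  dense-prefix : Dense A e → Bound A C ℓ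
  dense-prefix dense with dense-extend A C e (suc t) A0 Ae sums′ dense
                            (λ a a≤e Aa → subst (λ z → C ∋ z + a) (sym (+-suc e t)) (sums-top a a≤e Aa))
  ... | inj₁ h rewrite +-suc e t = inj₁ (arith e t p _ _ _ cnt-A h count-top)
    where
    arith : ∀ e t p k x y → k ≡ suc p → e + p + suc t ≤ x → suc x ≤ y → k + suc (e + t) ≤ y
    arith e t p _ x y refl h g = lin _ _ 0 (+-mono-≤ h g) (solve (e ∷ t ∷ p ∷ x ∷ y ∷ []))
  ... | inj₂ h rewrite +-suc e t = by-top h

  -- The at least 2p - 1 sums of elements up to e are multiples of g, and the p sums of these
  -- elements with ℓ are not.
  prefix-multiples : ∀ g → (∀ a → a ≤ e → A ∋ a → g ∣ a) → ¬ g ∣ ℓ → Bound A C ℓ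
  prefix-multiples g all g∤ℓ = by-top (arith p _ _ _ two one (cnt-classes g C (suc (e + ℓ))))
    where
    two : 2 * p ≤ suc (cnt (C ∩ multiple g) (suc (e + ℓ)))
    two = ≤-trans (≤-reflexive (cong (p +_) (+-identityʳ p)))
            (≤-trans (cnt-sum A e A e (C ∩ multiple g)
               (λ i j i≤e j≤e Ai Aj → ∩-intro C (multiple g) (sums′ i j i≤e j≤e Ai Aj)
                                        (multiple-intro (∣m∣n⇒∣m+n (all i i≤e Ai) (all j j≤e Aj))))
               (0 , z≤n , A0) (0 , z≤n , A0))
             (s≤s (cnt-grow (C ∩ multiple g) (s≤s (+-monoʳ-≤ e e≤ℓ)))))
    one : p ≤ cnt (C ∩ nonmultiple g) (suc (e + ℓ))
    one = ≤-trans (cnt-mono A (ℓ ▸ (C ∩ nonmultiple g)) (suc e) (λ a a≤e Aa →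
                     ∩-intro C (nonmultiple g) (sums-top a (s≤s⁻¹ a≤e) Aa)
                       (nonmultiple-intro (λ g∣ → g∤ℓ (∣m+n∣n⇒∣m g∣ (all a (s≤s⁻¹ a≤e) Aa))))))
                  (cnt-shift (C ∩ nonmultiple g) ℓ (suc e) (≤-reflexive (trans (+-suc ℓ e) (cong suc (+-comm ℓ e)))))
    arith : ∀ p x y z → 2 * p ≤ suc x → p ≤ y → x + y ≤ z → 3 * p ≤ suc z
    arith p x y z h g f = lin _ _ 0 (+-mono-≤ h (+-mono-≤ g f)) (solve (p ∷ x ∷ y ∷ z ∷ []))

  -- At least 3p - 3 sums use elements up to e only. Beyond these, ℓ + a is new by assumption and ℓ
  -- + e because it exceeds 2e; `by-top` supplies ℓ + ℓ.
  new-sum : ∀ a → a < e → A ∋ a → sumset A e (ℓ + a) ≡ false →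
            3 * p ≤ 3 + cnt (sumset A e) (suc (e + e)) → Bound A C ℓ
  new-sum a a<e Aa new h = by-top (arith p _ _ _ h new-count last)
    where
    new-count : suc (cnt (sumset A e) (suc (e + e))) ≤ cnt C (e + ℓ)
    new-count = ≤-trans (s≤s (cnt-grow (sumset A e) (≤-trans (≤-reflexive (sym (+-suc e e))) (+-monoʳ-≤ e (s≤s (m≤m+n e t))))))
      (cnt-strict (sumset A e) C (e + ℓ) (ℓ + a) sound (subst (ℓ + a <_) (+-comm ℓ e) (+-monoʳ-< ℓ a<e)) new (sums-top a (<⇒≤ a<e) Aa))
      where
      sound : ∀ z → z < e + ℓ → sumset A e ∋ z → C ∋ z
      sound z _ z∈ with sumset-sound A e z z∈
      ... | i , j , i≤e , j≤e , Ai , Aj , refl = sums′ i j i≤e j≤e Ai Aj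
    last : cnt C (suc (e + ℓ)) ≡ suc (cnt C (e + ℓ))
    last = cnt-last-true C (e + ℓ) (sums e ℓ e≤ℓ ≤-refl Ae Aℓ)
    arith : ∀ p x y z → 3 * p ≤ 3 + x → suc x ≤ y → z ≡ suc y → 3 * p ≤ suc z
    arith p x y _ h g refl = lin _ _ 0 (+-mono-≤ h g) (solve (p ∷ x ∷ y ∷ []))

  -- Measured down from ℓ, every element other than ℓ and e is a sum of two smaller ones,
  -- so all of them are multiples of the last gap.
  gap-divides : (∀ a → a < e → A ∋ a → sumset A e ∋ ℓ + a) →
                ∀ fuel a n → n < fuel → a ≤ e → A ∋ a → a + n ≡ ℓ → suc t ∣ n
  gap-divides closed (suc fuel) a n n<fuel a≤e Aa a+n≡ℓ with m≤n⇒m<n∨m≡n a≤e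
  ... | inj₂ refl = ∣-reflexive (sym (+-cancelˡ-≡ e n (suc t) (trans a+n≡ℓ (sym (+-suc e t)))))
  ... | inj₁ a<e with sumset-sound A e (ℓ + a) (closed a a<e Aa)
  ... | i , j , i≤e , j≤e , Ai , Aj , i+j≡ with m≤n⇒∃[o]m+o≡n (≤-trans i≤e e≤ℓ) | m≤n⇒∃[o]m+o≡n (≤-trans j≤e e≤ℓ)
  ... | x , i+x≡ℓ | y , j+y≡ℓ = subst (suc t ∣_) (sym n≡x+y)
        (∣m∣n⇒∣m+n (gap-divides closed fuel i x (<-≤-trans x<n (s≤s⁻¹ n<fuel)) i≤e Ai i+x≡ℓ)
                   (gap-divides closed fuel j y (<-≤-trans y<n (s≤s⁻¹ n<fuel)) j≤e Aj j+y≡ℓ))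
    where
    arith : ∀ a n i j x y ℓ → a + n ≡ ℓ → i + j ≡ ℓ + a → i + x ≡ ℓ → j + y ≡ ℓ → n ≡ x + y
    arith a n i j x y ℓ p q r s = +-cancelˡ-≡ (ℓ + a) n (x + y) (begin
      ℓ + a + n        ≡⟨ +-assoc ℓ a n ⟩
      ℓ + (a + n)      ≡⟨ cong₂ _+_ r (trans s (sym p)) ⟨
      i + x + (j + y)  ≡⟨ interchange i x j y ⟩
      i + j + (x + y)  ≡⟨ cong (_+ (x + y)) q ⟩
      ℓ + a + (x + y)  ∎)
      where open ≡-Reasoning
    -- With x = ℓ - i and y = ℓ - j, the equation i + j = ℓ + a reads n = x + y. Both summands are
    -- positive as i, j ≤ e < ℓ, so both are smaller than n.
    n≡x+y : n ≡ x + y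
    n≡x+y = arith a n i j x y ℓ a+n≡ℓ i+j≡ i+x≡ℓ j+y≡ℓ
    positive : ∀ i x → i ≤ e → i + x ≡ ℓ → 0 < x
    positive i zero    i≤e eq = ⊥-elim (1+n≰n (≤-trans (m≤m+n (suc e) t) (≤-trans (≤-reflexive (sym eq)) (≤-trans (≤-reflexive (+-identityʳ i)) i≤e))))
    positive i (suc x) i≤e eq = z<s
    x<n : x < n
    x<n = subst (x <_) (sym n≡x+y) (m<m+n x (positive j y j≤e j+y≡ℓ))
    y<n : y < n
    y<n = subst (y <_) (sym n≡x+y) (m<n+m y (positive i x i≤e i+x≡ℓ))

  -- The gap divides every distance to ℓ, in particular ℓ itself as the distance of 0, hence every
  -- element.
  gap-trivial : Coprime A ℓ → (∀ a → a < e → A ∋ a → sumset A e ∋ ℓ + a) → suc t ≡ 1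
  gap-trivial coprime closed = coprime (suc t) divides-all
    where
    γ∣ℓ : suc t ∣ ℓ
    γ∣ℓ = gap-divides closed (suc ℓ) 0 ℓ ≤-refl z≤n A0 refl
    divides-all : ∀ a → a ≤ ℓ → A ∋ a → suc t ∣ a
    divides-all a a≤ℓ Aa with gap-jump A e t a gap a≤ℓ Aa
    ... | inj₂ refl = γ∣ℓ
    ... | inj₁ a≤e with m≤n⇒∃[o]m+o≡n a≤ℓ
    ... | n , a+n≡ℓ = ∣m+n∣n⇒∣m (subst (suc t ∣_) (sym a+n≡ℓ) γ∣ℓ)
                        (gap-divides closed (suc n) a n ≤-refl a≤e Aa a+n≡ℓ)

  -- Either some ℓ + a with a < e is not a sum of two elements up to e, and the induction hypothesis
  -- for the exact sumset of this prefix gains three sums, or `gap-trivial` makes the last gap 1.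
  coprime-prefix : Freiman e → Coprime A ℓ → ¬ Dense A e → Coprime A e → suc t ≢ 1 → Bound A C ℓ
  coprime-prefix ih coprime sparse′ coprime′ t≢0 with search (A ∩ λ a → not (sumset A e (ℓ + a))) e
  ... | inj₁ (a , a<e , both) = new-sum a a<e (proj₁ (∧-elim both)) (not-true (proj₂ (∧-elim {A a} both)))
          (nondense-bound A (sumset A e) e (<⇒≤ (≰⇒> sparse′))
            (ih A (sumset A e) A0 Ae (sumset-complete A e) coprime′))
    where
    not-true : ∀ {b} → not b ≡ true → b ≡ false
    not-true {false} _ = refl
  ... | inj₂ none = ⊥-elim (t≢0 (gap-trivial coprime closed))
    where
    closed : ∀ a → a < e → A ∋ a → sumset A e ∋ ℓ + a
    closed a a<e Aa with sumset A e (ℓ + a) in eq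
    ... | true  = refl
    ... | false = ⊥-elim (true≢false (∩-intro A (λ a → not (sumset A e (ℓ + a))) Aa (cong not eq)) (none a a<e))

  wide-gap : Freiman e → Coprime A ℓ → suc t ≢ 1 → Bound A C ℓ
  wide-gap ih coprime t≢0 with e + 3 ≤? 2 * p | gcdOf A (suc e) ≟ 1
  ... | yes dense | _ = dense-prefix dense
  ... | no sparse′ | yes g≡1 = coprime-prefix ih coprime sparse′
          (λ h all → ∣1⇒≡1 (subst (h ∣_) g≡1 (gcdOf-greatest A (suc e) h (λ a a<1+e → all a (s≤s⁻¹ a<1+e))))) t≢0
  -- If the gcd of the prefix divided ℓ, it would divide all of `A`. This includes gcd 0, when the
  -- prefix is {0}.
  ... | no _ | no g≢1 = prefix-multiples (gcdOf A (suc e)) all (λ g∣ℓ → g≢1 (coprime _ (all′ g∣ℓ)))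
    where
    all : ∀ a → a ≤ e → A ∋ a → gcdOf A (suc e) ∣ a
    all a a≤e = gcdOf-∣ A (suc e) a (s≤s a≤e)
    all′ : gcdOf A (suc e) ∣ ℓ → ∀ a → a ≤ ℓ → A ∋ a → gcdOf A (suc e) ∣ a
    all′ g∣ℓ a a≤ℓ Aa with gap-jump A e t a gap a≤ℓ Aa
    ... | inj₁ a≤e  = all a a≤e Aa
    ... | inj₂ refl = g∣ℓ

-- Freiman's theorem: splitting in the middle

outside : ℕ → ℕ → Pred
outside lo hi z = does (z ≤? lo) ∨ does (hi ≤? z)

outside-low : ∀ {lo hi z} → z ≤ lo → outside lo hi ∋ z
outside-low {lo} {hi} {z} z≤lo = cong (_∨ does (hi ≤? z)) (dec-true (z ≤? lo) z≤lo)

outside-high : ∀ {lo hi z} → hi ≤ z → outside lo hi ∋ z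
outside-high {lo} {hi} {z} hi≤z with does (z ≤? lo)
... | true  = refl
... | false = dec-true (hi ≤? z) hi≤z

outside-gap : ∀ C lo hi z → lo < z → z < hi → (C ∩ outside lo hi) z ≡ false
outside-gap C lo hi z lo<z z<hi
  rewrite dec-false (z ≤? lo) (<⇒≱ lo<z) | dec-false (hi ≤? z) (<⇒≱ z<hi) with C z
... | true  = refl
... | false = refl

module Split (A C : Pred) (u t w : ℕ) (Au : A ∋ u) (Av : A ∋ suc u + t) (gap : Gap A u t)
             (sums : Sums A (suc u + t + w) A (suc u + t + w) C) where

  v L ℓ : ℕ
  v = suc u + t
  L = suc t + w
  ℓ = v + w

  u+L≡ℓ : u + L ≡ ℓ
  u+L≡ℓ = eq u t w
    where
    eq : ∀ u t w → u + (suc t + w) ≡ suc u + t + w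
    eq u t w = solve (u ∷ t ∷ w ∷ [])

  -- As u and v are consecutive, two elements up to v have sum 2v or at most u + v, and two elements
  -- from u on have sum 2u or at least u + v. `C` is cut down accordingly, `upper` in coordinates
  -- starting at 2u.
  lower upper : Pred
  lower = C ∩ outside (u + v) (v + v)
  upper = ((u + u) ▸ C) ∩ outside 0 (suc t)

  sums-lower : Sums A v A v lower
  sums-lower i j i≤v j≤v Ai Aj =
    ∩-intro C (outside (u + v) (v + v)) (sums i j (≤-trans i≤v (m≤m+n v w)) (≤-trans j≤v (m≤m+n v w)) Ai Aj)
      (place (gap-jump A u t i gap i≤v Ai) (gap-jump A u t j gap j≤v Aj))
    where
    place : i ≤ u ⊎ i ≡ v → j ≤ u ⊎ j ≡ v → outside (u + v) (v + v) ∋ i + j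
    place (inj₁ i≤u)  _           = outside-low {hi = v + v} (+-mono-≤ i≤u j≤v)
    place (inj₂ refl) (inj₁ j≤u)  = outside-low {hi = v + v} (≤-trans (+-monoʳ-≤ v j≤u) (≤-reflexive (+-comm v u)))
    place (inj₂ refl) (inj₂ refl) = outside-high {u + v} {v + v} {v + v} ≤-refl

  sums-upper : Sums (u ▸ A) L (u ▸ A) L upper
  sums-upper i j i≤L j≤L Ai Aj =
    ∩-intro ((u + u) ▸ C) (outside 0 (suc t))
      (subst (C ∋_) (interchange u i u j) (sums (u + i) (u + j) (bound i≤L) (bound j≤L) Ai Aj))
      (place i j Ai Aj)
    where
    bound : ∀ {i} → i ≤ L → u + i ≤ ℓ
    bound i≤L = ≤-trans (+-monoʳ-≤ u i≤L) (≤-reflexive u+L≡ℓ)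
    far : ∀ i → A ∋ u + suc i → suc t ≤ suc i
    far i Ai with i <? t
    ... | yes i<t = ⊥-elim (true≢false Ai (trans (cong A (+-suc u i)) (gap i i<t)))
    ... | no i≮t  = s≤s (≮⇒≥ i≮t)
    place : ∀ i j → A ∋ u + i → A ∋ u + j → outside 0 (suc t) ∋ i + j
    place zero    zero    _  _  = refl
    place zero    (suc j) _  Aj = outside-high {lo = 0} {z = suc j} (far j Aj)
    place (suc i) j       Ai _  = outside-high {lo = 0} {z = suc i + j} (≤-trans (far i Ai) (m≤m+n (suc i) j))

  -- The 2 pays for u + v and 2v, the only possible points of `lower` from u + v on.
  cnt-lower : cnt lower (suc (v + v)) ≤ 2 + cnt C (u + v)
  cnt-lower = begin
    cnt lower (suc (v + v))                                               ≡⟨ cnt-splitAt lower (suc (u + v)) (suc t) (eq u t) ⟩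
    cnt lower (suc (u + v)) + cnt (suc (u + v) ▸ lower) (suc t)           ≡⟨ cong₂ _+_ (cnt-last lower (u + v)) (cnt-last (suc (u + v) ▸ lower) t) ⟩
    cnt lower (u + v) + bit (lower (u + v)) + (cnt (suc (u + v) ▸ lower) t + bit (lower (suc (u + v) + t)))
      ≤⟨ +-mono-≤ (+-mono-≤ (cnt-mono lower C (u + v) (λ i _ m → proj₁ (∧-elim m))) (bit≤1 (lower (u + v))))
                  (+-mono-≤ (≤-reflexive (cnt-none (suc (u + v) ▸ lower) t empty)) (bit≤1 (lower (suc (u + v) + t)))) ⟩
    cnt C (u + v) + 1 + (0 + 1)                                           ≡⟨ +-assoc (cnt C (u + v)) 1 1 ⟩
    cnt C (u + v) + 2                                                     ≡⟨ +-comm (cnt C (u + v)) 2 ⟩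
    2 + cnt C (u + v)                                                     ∎
    where
    open ≤-Reasoning
    eq : ∀ u t → suc (u + (suc u + t)) + suc t ≡ suc ((suc u + t) + (suc u + t))
    eq u t = solve (u ∷ t ∷ [])
    eq′ : ∀ u t → suc (u + (suc u + t)) + t ≡ (suc u + t) + (suc u + t)
    eq′ u t = solve (u ∷ t ∷ [])
    empty : ∀ i → i < t → lower (suc (u + v) + i) ≡ false
    empty i i<t = outside-gap C (u + v) (v + v) _ (m≤m+n (suc (u + v)) i)
                    (<-≤-trans (+-monoʳ-< (suc (u + v)) i<t) (≤-reflexive (eq′ u t)))

  -- The 1 pays for 2u. The other points of `upper` stand for points of `C` from u + v on, where
  -- `cnt C (u + v)` has stopped.
  cnt-upper : cnt upper (suc (L + L)) + cnt C (u + v) ≤ 1 + cnt C (suc (ℓ + ℓ))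
  cnt-upper = begin
    cnt upper (suc (L + L)) + cnt C (u + v)                               ≡⟨ cong (_+ cnt C (u + v)) (cnt-splitAt upper (suc t) rest (eq₁ t w)) ⟩
    bit (upper 0) + cnt (1 ▸ upper) t + cnt (suc t ▸ upper) rest + cnt C (u + v)
      ≤⟨ +-monoˡ-≤ (cnt C (u + v)) (+-mono-≤ (+-mono-≤ (bit≤1 (upper 0)) (≤-reflexive (cnt-none (1 ▸ upper) t
           (λ i i<t → outside-gap ((u + u) ▸ C) 0 (suc t) (suc i) z<s (s<s i<t)))))
           (cnt-mono (suc t ▸ upper) ((u + v) ▸ C) rest (λ i _ m → subst (C ∋_) (eq₃ u t i) (proj₁ (∧-elim m))))) ⟩
    suc (cnt ((u + v) ▸ C) rest + cnt C (u + v))                          ≡⟨ cong suc (+-comm _ (cnt C (u + v))) ⟩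
    suc (cnt C (u + v) + cnt ((u + v) ▸ C) rest)                          ≡⟨ cong suc (cnt-splitAt C (u + v) rest (eq₂ u t w)) ⟨
    1 + cnt C (suc (ℓ + ℓ))                                               ∎
    where
    open ≤-Reasoning
    rest : ℕ
    rest = suc (w + suc (t + w))
    eq₁ : ∀ t w → suc t + suc (w + suc (t + w)) ≡ suc ((suc t + w) + (suc t + w))
    eq₁ t w = solve (t ∷ w ∷ [])
    eq₂ : ∀ u t w → u + (suc u + t) + suc (w + suc (t + w)) ≡ suc ((suc u + t + w) + (suc u + t + w))
    eq₂ u t w = solve (u ∷ t ∷ w ∷ [])
    eq₃ : ∀ u t i → u + u + (suc t + i) ≡ u + (suc u + t) + i
    eq₃ u t i = solve (u ∷ t ∷ i ∷ [])

  -- The sums of the elements up to v, bar 2v, end at u + v, where the sums of the elements from u on, bar 2u, begin.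
  combine : Bound A lower v → Bound (u ▸ A) upper L → u + 3 ≤ 2 * cnt A (suc u) → 2 * cnt A (suc v) ≤ v + 3 →
            2 * cnt A (suc ℓ) ≤ ℓ + 2 → 3 * cnt A (suc ℓ) ≤ 3 + cnt C (suc (ℓ + ℓ))
  combine bound₁ bound₂ dense₁ sparse₁ sparse₂ = arith₂ (cnt A u) (cnt A (suc u)) (cnt A (suc v)) (cnt (u ▸ A) (suc L)) (cnt A (suc ℓ)) _ _ _ _
    (cnt-last-true A u Au) (cnt-gap A u t gap Av) k-split
    (nondense-bound A lower v sparse₁ bound₁) (nondense-bound (u ▸ A) upper L sparse₃ bound₂) cnt-lower cnt-upper
    where
    k-split : cnt A (suc ℓ) ≡ cnt A u + cnt (u ▸ A) (suc L)
    k-split = cnt-splitAt A u (suc L) (trans (+-suc u L) (cong suc u+L≡ℓ))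
    arith₁ : ∀ u L ℓ a a′ k n → u + L ≡ ℓ → a′ ≡ suc a → k ≡ a + n → u + 3 ≤ 2 * a′ → 2 * k ≤ ℓ + 2 → 2 * n ≤ L + 3
    arith₁ u L _ a _ _ n refl refl refl p q = lin _ _ 2 (+-mono-≤ p q) (solve (u ∷ L ∷ a ∷ n ∷ []))
    sparse₃ : 2 * cnt (u ▸ A) (suc L) ≤ L + 3
    sparse₃ = arith₁ u L ℓ (cnt A u) (cnt A (suc u)) (cnt A (suc ℓ)) _ u+L≡ℓ (cnt-last-true A u Au) k-split dense₁ sparse₂
    -- Both pieces contain u and v, so nv + n = k + 2 and the bounds 3nv - 3 and 3n - 3 add up to
    -- 3k; the overlap of the two counts costs 2 + 1.
    arith₂ : ∀ a a′ nv n k x y c c′ → a′ ≡ suc a → nv ≡ suc a′ → k ≡ a + n → 3 * nv ≤ 3 + x → 3 * n ≤ 3 + y →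
             x ≤ 2 + c → y + c ≤ 1 + c′ → 3 * k ≤ 3 + c′
    arith₂ a _ _ n _ x y c c′ refl refl refl p q r s =
      lin _ _ 0 (+-mono-≤ p (+-mono-≤ q (+-mono-≤ r s))) (solve (a ∷ n ∷ x ∷ y ∷ c ∷ c′ ∷ []))

record Middle (A : Pred) (ℓ′ : ℕ) : Set where
  field
    u t w  : ℕ
    u≥1    : 1 ≤ u
    end    : suc u + t + w ≡ ℓ′
    Au     : A ∋ u
    Av     : A ∋ suc u + t
    gap    : Gap A u t
    dense  : u + 3 ≤ 2 * cnt A (suc u)
    sparse : 2 * cnt A (suc (suc u + t)) ≤ suc u + t + 3

-- `A` is followed element by element, with x = ℓ′ - u. Density up to ℓ′ would contradict 2|A| ≤ ℓ′
-- + 3, since ℓ′ + 1 is one more element; so at some step u is dense and the next element v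
-- satisfies the opposite inequality.
middle : ∀ A ℓ′ → A ∋ ℓ′ → A ∋ suc ℓ′ → 2 * cnt A (suc (suc ℓ′)) ≤ suc ℓ′ + 2 →
         ∀ fuel u x → x < fuel → u + x ≡ ℓ′ → 1 ≤ u → A ∋ u → u + 3 ≤ 2 * cnt A (suc u) → Middle A ℓ′
middle A ℓ′ Aℓ′ Aℓ few (suc fuel) u zero _ u+0≡ℓ′ u≥1 Au dense =
  ⊥-elim (1+n≰n (arith u ℓ′ (cnt A (suc ℓ′)) (cnt A (suc (suc ℓ′))) (trans (sym (+-identityʳ u)) u+0≡ℓ′) (cnt-last-true A (suc ℓ′) Aℓ)
    (subst (λ z → u + 3 ≤ 2 * cnt A (suc z)) (trans (sym (+-identityʳ u)) u+0≡ℓ′) dense) few))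
  where
  arith : ∀ u ℓ′ a k → u ≡ ℓ′ → k ≡ suc a → u + 3 ≤ 2 * a → 2 * k ≤ suc ℓ′ + 2 → 1 ≤ 0
  arith u _ a _ refl refl p q = lin 1 0 1 (+-mono-≤ p q) (solve (u ∷ a ∷ []))
middle A ℓ′ Aℓ′ Aℓ few (suc fuel) u (suc x) x<fuel u+x≡ℓ′ u≥1 Au dense
  with firstTrue (suc u ▸ A) x (subst (A ∋_) (sym (trans (sym (+-suc u x)) u+x≡ℓ′)) Aℓ′)
... | t , t≤x , Av , gap with m≤n⇒∃[o]m+o≡n t≤x
... | w , refl with 2 * cnt A (suc (suc u + t)) ≤? suc u + t + 3
... | yes sparse = record { u≥1 = u≥1 ; end = end ; Au = Au ; Av = Av ; gap = gap ; dense = dense ; sparse = sparse }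
  where
  end : suc u + t + w ≡ ℓ′
  end = trans (+-assoc (suc u) t w) (trans (sym (+-suc u (t + w))) u+x≡ℓ′)
... | no ¬sparse = middle A ℓ′ Aℓ′ Aℓ few fuel (suc u + t) w (≤-trans (s≤s (m≤n+m w t)) (s≤s⁻¹ x<fuel))
        (trans (+-assoc (suc u) t w) (trans (sym (+-suc u (t + w))) u+x≡ℓ′)) (s≤s z≤n) Av (<⇒≤ (≰⇒> ¬sparse))

-- The gaps of 1 make both pieces coprime: the lower one contains 0 and 1, the upper one ends in two
-- consecutive elements. Since 1 ≤ u and v ≤ ℓ′, both are shorter than `A`, so the induction
-- hypothesis applies.
both-ends : ∀ ℓ′ → (∀ m → m < suc ℓ′ → Freiman m) → ∀ A C → A ∋ 0 → A ∋ 1 → A ∋ ℓ′ → A ∋ suc ℓ′ →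
            Sums A (suc ℓ′) A (suc ℓ′) C → 2 * cnt A (suc (suc ℓ′)) ≤ suc ℓ′ + 2 → Bound A C (suc ℓ′)
both-ends zero ih A C A0 A1 Aℓ′ Aℓ sums few rewrite A0 | A1 = ⊥-elim (1+n≰n few)
both-ends (suc x) ih A C A0 A1 Aℓ′ Aℓ sums few
  with middle A (suc x) Aℓ′ Aℓ few (suc x) 1 x ≤-refl refl ≤-refl A1 two
  where
  two : 4 ≤ 2 * cnt A 2
  two rewrite A0 | A1 = ≤-refl
... | record { u = u ; t = t ; w = w ; u≥1 = u≥1 ; end = end ; Au = Au ; Av = Av ; gap = gap ; dense = dense ; sparse = sparse }
  with trans (+-suc (suc u + t) w) (cong suc end)
... | end′ = inj₂ (subst (λ ℓ → 3 * cnt A (suc ℓ) ≤ 3 + cnt C (suc (ℓ + ℓ))) end′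
        (combine
          (ih v v<ℓ A lower A0 Av sums-lower coprime-lower)
          (ih L L<ℓ (u ▸ A) upper (subst (A ∋_) (sym (+-identityʳ u)) Au)
            (subst (A ∋_) (sym (trans u+L≡ℓ end′)) Aℓ) sums-upper coprime-upper)
          dense sparse (subst (λ ℓ → 2 * cnt A (suc ℓ) ≤ ℓ + 2) (sym end′) few)))
  where
  open Split A C u t (suc w) Au Av gap (subst (λ ℓ → Sums A ℓ A ℓ C) (sym end′) sums)
  v<ℓ : v < suc (suc x)
  v<ℓ = s≤s (≤-trans (m≤m+n v w) (≤-reflexive end))
  L<ℓ : L < suc (suc x)
  L<ℓ = ≤-trans (+-monoˡ-≤ L u≥1) (≤-reflexive (trans u+L≡ℓ end′))
  coprime-lower : Coprime A v
  coprime-lower g all = ∣1⇒≡1 (all 1 (s≤s z≤n) A1)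
  coprime-upper : Coprime (u ▸ A) L
  coprime-upper g all = ∣1⇒≡1 (∣m+n∣m⇒∣n {g} {suc t + w} {1}
      (subst (g ∣_) (trans (+-suc (suc t) w) (+-comm 1 (suc t + w))) (all L ≤-refl (subst (A ∋_) (sym (trans u+L≡ℓ end′)) Aℓ)))
      (all (suc t + w) (+-monoʳ-≤ (suc t) (n≤1+n w)) (subst (A ∋_) (sym (trans (eq u t w) end)) Aℓ′)))
    where
    eq : ∀ u t w → u + (suc t + w) ≡ suc u + t + w
    eq u t w = solve (u ∷ t ∷ w ∷ [])

-- Freiman's theorem: reflection and induction

wide-last-gap : ∀ ℓ → (∀ m → m < ℓ → Freiman m) → ∀ A C → A ∋ 0 → A ∋ ℓ → Sums A ℓ A ℓ C → Coprime A ℓ →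
                (∃[ ℓ′ ] (ℓ ≡ suc ℓ′ × A ∋ ℓ′)) ⊎ Bound A C ℓ
-- When ℓ = 0, even 0 divides every element, which coprimality rules out.
wide-last-gap zero ih A C A0 Aℓ sums coprime with coprime 0 (λ a a≤0 _ → ∣-reflexive (sym (n≤0⇒n≡0 a≤0)))
... | ()
wide-last-gap (suc ℓ′) ih A C A0 Aℓ sums coprime with lastTrue A (suc ℓ′) A0 (s≤s z≤n)
... | e , zero  , refl , Ae , gap = inj₁ (e + 0 , refl , subst (A ∋_) (sym (+-identityʳ e)) Ae)
... | e , suc t , refl , Ae , gap = inj₂ (LastGap.wide-gap A C e (suc t) A0 Ae Aℓ gap sums (ih e (s≤s (m≤m+n e (suc t)))) coprime (λ ()))

mirror-sums : ∀ A C ℓ → Sums A ℓ A ℓ C → Sums (mirror ℓ A) ℓ (mirror ℓ A) ℓ (mirror (ℓ + ℓ) C)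
mirror-sums A C ℓ sums i j i≤ℓ j≤ℓ Ai Aj =
  subst (C ∋_) eq (sums (ℓ ∸ i) (ℓ ∸ j) (m∸n≤m ℓ i) (m∸n≤m ℓ j) Ai Aj)
  where
  eq : (ℓ ∸ i) + (ℓ ∸ j) ≡ ℓ + ℓ ∸ (i + j)
  eq = begin
    (ℓ ∸ i) + (ℓ ∸ j)                        ≡⟨ m+n∸m≡n (i + j) _ ⟨
    i + j + ((ℓ ∸ i) + (ℓ ∸ j)) ∸ (i + j)    ≡⟨ cong (_∸ (i + j)) (interchange i j (ℓ ∸ i) (ℓ ∸ j)) ⟩
    i + (ℓ ∸ i) + (j + (ℓ ∸ j)) ∸ (i + j)    ≡⟨ cong₂ (λ x y → x + y ∸ (i + j)) (m+[n∸m]≡n i≤ℓ) (m+[n∸m]≡n j≤ℓ) ⟩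
    ℓ + ℓ ∸ (i + j)                          ∎
    where open ≡-Reasoning

mirror-coprime : ∀ A ℓ → A ∋ 0 → A ∋ ℓ → Coprime A ℓ → Coprime (mirror ℓ A) ℓ
mirror-coprime A ℓ A0 Aℓ coprime g all = coprime g λ a a≤ℓ Aa →
  ∣m+n∣n⇒∣m (subst (g ∣_) (sym (m+[n∸m]≡n a≤ℓ)) g∣ℓ)
            (all (ℓ ∸ a) (m∸n≤m ℓ a) (subst (A ∋_) (sym (m∸[m∸n]≡n a≤ℓ)) Aa))
  where
  g∣ℓ : g ∣ ℓ
  g∣ℓ = all ℓ ≤-refl (subst (A ∋_) (sym (n∸n≡0 ℓ)) A0)

mirror-bound : ∀ A C ℓ → Bound (mirror ℓ A) (mirror (ℓ + ℓ) C) ℓ → Bound A C ℓ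
mirror-bound A C ℓ = subst₂ (λ k c → k + ℓ ≤ c ⊎ 3 * k ≤ 3 + c) (cnt-mirror A ℓ) (cnt-mirror C (ℓ + ℓ))

-- The reflection x ↦ ℓ - x preserves hypotheses and counts and makes the first gap the last one.
-- What remains are sets containing 0, 1, ℓ - 1 and ℓ.
freiman-step : ∀ ℓ → (∀ m → m < ℓ → Freiman m) → Freiman ℓ
freiman-step ℓ ih A C A0 Aℓ sums coprime with ℓ + 3 ≤? 2 * cnt A (suc ℓ)
... | yes dense = inj₁ (dense-bound A C ℓ A0 Aℓ sums dense)
... | no ¬dense with wide-last-gap ℓ ih A C A0 Aℓ sums coprime
... | inj₂ bound = bound
... | inj₁ (ℓ′ , refl , Aℓ′)
  with wide-last-gap ℓ ih (mirror ℓ A) (mirror (ℓ + ℓ) C) Aℓ (subst (A ∋_) (sym (n∸n≡0 ℓ)) A0)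
         (mirror-sums A C ℓ sums) (mirror-coprime A ℓ A0 Aℓ coprime)
... | inj₂ bound = mirror-bound A C ℓ bound
... | inj₁ (.ℓ′ , refl , A1) = both-ends ℓ′ ih A C A0 (subst (A ∋_) (m+n∸n≡m 1 ℓ′) A1) Aℓ′ Aℓ sums
        (s≤s⁻¹ (≤-trans (≰⇒> ¬dense) (≤-reflexive (+-suc (suc ℓ′) 2))))

freiman : ∀ ℓ → Freiman ℓ
freiman = <-rec Freiman (λ ℓ ih → freiman-step ℓ (λ m → ih {m}))

-- Two sets with the same difference

-- Split `Y` into multiples and non-multiples of g, both non-empty. The two parts have disjoint sums
-- with `X`, and each costs 1 in `cnt-sum`.
cnt-sum-two-classes : ∀ g X m Y n E → Sums X m Y n E → X ∋ 0 → Y ∋ 0 → (∀ a → a ≤ m → X ∋ a → g ∣ a) →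
  ∀ j → j ≤ n → Y ∋ j → ¬ g ∣ j → 2 * cnt X (suc m) + cnt Y (suc n) ≤ 2 + cnt E (suc (m + n))
cnt-sum-two-classes g X m Y n E sums X0 Y0 all j j≤n Yj g∤j =
  arith (cnt X (suc m)) (cnt Y (suc n)) _ _ _ _ _ split
    (cnt-sum X m (Y ∩ multiple g) n (E ∩ multiple g) sums₁ (0 , z≤n , X0)
      (0 , z≤n , ∩-intro Y (multiple g) Y0 (multiple-intro (g ∣0))))
    (cnt-sum X m (Y ∩ nonmultiple g) n (E ∩ nonmultiple g) sums₂ (0 , z≤n , X0)
      (j , j≤n , ∩-intro Y (nonmultiple g) Yj (nonmultiple-intro g∤j)))
    (cnt-classes g E (suc (m + n)))
  where
  sums₁ : Sums X m (Y ∩ multiple g) n (E ∩ multiple g)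
  sums₁ i j i≤m j≤n Xi Yj = let Yj , g∣j = ∧-elim Yj in
    ∩-intro E (multiple g) (sums i j i≤m j≤n Xi Yj)
      (multiple-intro (∣m∣n⇒∣m+n (all i i≤m Xi) (witness (g ∣? j) g∣j)))
  sums₂ : Sums X m (Y ∩ nonmultiple g) n (E ∩ nonmultiple g)
  sums₂ i j i≤m j≤n Xi Yj = let Yj , g∤j = ∧-elim Yj in
    ∩-intro E (nonmultiple g) (sums i j i≤m j≤n Xi Yj)
      (nonmultiple-intro (λ g∣ → true≢false g∤j (cong not (multiple-intro (∣m+n∣m⇒∣n g∣ (all i i≤m Xi))))))
  split : cnt Y (suc n) ≤ cnt (Y ∩ multiple g) (suc n) + cnt (Y ∩ nonmultiple g) (suc n)
  split = cnt-union (Y ∩ multiple g) (Y ∩ nonmultiple g) Y (suc n) (λ i _ → classify i (g ∣? i))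
    where
    classify : ∀ i → Dec (g ∣ i) → Y ∋ i → Y ∩ multiple g ∋ i ⊎ Y ∩ nonmultiple g ∋ i
    classify i (yes g∣i) Yi = inj₁ (∩-intro Y (multiple g) Yi (multiple-intro g∣i))
    classify i (no  g∤i) Yi = inj₂ (∩-intro Y (nonmultiple g) Yi (nonmultiple-intro g∤i))
  arith : ∀ x y y₁ y₂ e₁ e₂ e → y ≤ y₁ + y₂ → x + y₁ ≤ suc e₁ → x + y₂ ≤ suc e₂ → e₁ + e₂ ≤ e → 2 * x + y ≤ 2 + e
  arith x y y₁ y₂ e₁ e₂ e p q r s =
    lin _ _ 0 (+-mono-≤ p (+-mono-≤ q (+-mono-≤ r s))) (solve (x ∷ y ∷ y₁ ∷ y₂ ∷ e₁ ∷ e₂ ∷ e ∷ []))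

sums-swap : ∀ X m Y n E → Sums X m Y n E → Sums Y n X m E
sums-swap X m Y n E sums j i j≤n i≤m Yj Xi = subst (E ∋_) (+-comm i j) (sums i j i≤m j≤n Xi Yj)

-- The two pieces in index coordinates, each with least element 0. `C`, `E` and `D` contain their
-- three sumsets; `total` and `small` express |2A| ≤ 3k - 3 + b and b < k/3 - 2 for the whole set,
-- without subtraction.
record System (A B C E D : Pred) (ℓ₁ ℓ₂ b : ℕ) : Set where
  field
    A-first : A ∋ 0
    A-last  : A ∋ ℓ₁
    B-first : B ∋ 0
    B-last  : B ∋ ℓ₂
    sums-AA : Sums A ℓ₁ A ℓ₁ C
    sums-AB : Sums A ℓ₁ B ℓ₂ E
    sums-BB : Sums B ℓ₂ B ℓ₂ D
    total   : cnt C (suc (ℓ₁ + ℓ₁)) + cnt E (suc (ℓ₁ + ℓ₂)) + cnt D (suc (ℓ₂ + ℓ₂)) + 3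
              ≤ 3 * (cnt A (suc ℓ₁) + cnt B (suc ℓ₂)) + b
    small   : 3 * b + 7 ≤ cnt A (suc ℓ₁) + cnt B (suc ℓ₂)

  k₁ k₂ : ℕ
  k₁ = cnt A (suc ℓ₁)
  k₂ = cnt B (suc ℓ₂)

  s-AA s-AB s-BB : ℕ
  s-AA = cnt C (suc (ℓ₁ + ℓ₁))
  s-AB = cnt E (suc (ℓ₁ + ℓ₂))
  s-BB = cnt D (suc (ℓ₂ + ℓ₂))

  least-AA : 2 * k₁ ≤ suc (cnt C (suc (ℓ₁ + ℓ₁)))
  least-AA = ≤-trans (≤-reflexive (cong (k₁ +_) (+-identityʳ k₁)))
                     (cnt-sum A ℓ₁ A ℓ₁ C sums-AA (0 , z≤n , A-first) (0 , z≤n , A-first))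

  least-AB : k₁ + k₂ ≤ suc (cnt E (suc (ℓ₁ + ℓ₂)))
  least-AB = cnt-sum A ℓ₁ B ℓ₂ E sums-AB (0 , z≤n , A-first) (0 , z≤n , B-first)

  least-BB : 2 * k₂ ≤ suc (cnt D (suc (ℓ₂ + ℓ₂)))
  least-BB = ≤-trans (≤-reflexive (cong (k₂ +_) (+-identityʳ k₂)))
                     (cnt-sum B ℓ₂ B ℓ₂ D sums-BB (0 , z≤n , B-first) (0 , z≤n , B-first))

swap : ∀ {A B C E D ℓ₁ ℓ₂ b} → System A B C E D ℓ₁ ℓ₂ b → System B A D E C ℓ₂ ℓ₁ b
swap {A} {B} {C} {E} {D} {ℓ₁} {ℓ₂} {b} S = record
  { A-first = B-first ; A-last = B-last ; B-first = A-first ; B-last = A-last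
  ; sums-AA = sums-BB ; sums-AB = sums-swap A ℓ₁ B ℓ₂ E sums-AB ; sums-BB = sums-AA
  ; total = arith s-AA _ _ s-BB k₁ k₂ b (cong (λ z → cnt E (suc z)) (+-comm ℓ₁ ℓ₂)) total
  ; small = ≤-trans small (≤-reflexive (+-comm k₁ k₂))
  }
  where
  open System S
  arith : ∀ c e e′ d k₁ k₂ b → e ≡ e′ → c + e + d + 3 ≤ 3 * (k₁ + k₂) + b → d + e′ + c + 3 ≤ 3 * (k₂ + k₁) + b
  arith c e _ d k₁ k₂ b refl p = lin _ _ 0 p (solve (c ∷ e ∷ d ∷ k₁ ∷ k₂ ∷ b ∷ []))

-- Otherwise the three sumsets have at least (2k₁ - 1) + (2k₁ + k₂ - 2) + (2k₂ - 1) elements, and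
-- `total` gives k₁ ≤ b + 1.
common-divisor : ∀ {A B C E D ℓ₁ ℓ₂ b} (S : System A B C E D ℓ₁ ℓ₂ b) → b + 3 ≤ System.k₁ S →
  ∀ g → (∀ a → a ≤ ℓ₁ → A ∋ a → g ∣ a) → ∀ j → j ≤ ℓ₂ → B ∋ j → g ∣ j
common-divisor {A} {B} {C} {E} {D} {ℓ₁} {ℓ₂} {b} S large g all j j≤ℓ₂ Bj with g ∣? j
... | yes g∣j = g∣j
... | no  g∤j = ⊥-elim (1+n≰n (arith k₁ k₂ b _ _ _ large least-AA
                  (cnt-sum-two-classes g A ℓ₁ B ℓ₂ E sums-AB A-first B-first all j j≤ℓ₂ Bj g∤j) least-BB total))
  where
  open System S
  arith : ∀ k₁ k₂ b c e d → b + 3 ≤ k₁ → 2 * k₁ ≤ suc c → 2 * k₁ + k₂ ≤ 2 + e → 2 * k₂ ≤ suc d →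
          c + e + d + 3 ≤ 3 * (k₁ + k₂) + b → 1 ≤ 0
  arith k₁ k₂ b c e d o p q r s = lin 1 0 1 (+-mono-≤ o (+-mono-≤ p (+-mono-≤ q (+-mono-≤ r s))))
                                       (solve (k₁ ∷ k₂ ∷ b ∷ c ∷ e ∷ d ∷ []))

-- The alternative 3k₁ - 3, with the trivial bounds for the other two sumsets, leads to k₁ ≤ b + 2.
-- This is the source of the threshold b + 3.
freiman-system : ∀ {A B C E D ℓ₁ ℓ₂ b} (S : System A B C E D ℓ₁ ℓ₂ b) → b + 3 ≤ System.k₁ S → Coprime A ℓ₁ →
  cnt A (suc ℓ₁) + ℓ₁ ≤ cnt C (suc (ℓ₁ + ℓ₁))
freiman-system {A} {B} {C} {E} {D} {ℓ₁} {ℓ₂} {b} S large coprime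
  with freiman ℓ₁ A C (System.A-first S) (System.A-last S) (System.sums-AA S) coprime
... | inj₁ h = h
... | inj₂ h = ⊥-elim (1+n≰n (arith k₁ k₂ b _ _ _ large h least-AB least-BB total))
  where
  open System S
  arith : ∀ k₁ k₂ b c e d → b + 3 ≤ k₁ → 3 * k₁ ≤ 3 + c → k₁ + k₂ ≤ suc e → 2 * k₂ ≤ suc d →
          c + e + d + 3 ≤ 3 * (k₁ + k₂) + b → 1 ≤ 0
  arith k₁ k₂ b c e d o p q r s = lin 1 0 0 (+-mono-≤ o (+-mono-≤ p (+-mono-≤ q (+-mono-≤ r s))))
                                       (solve (k₁ ∷ k₂ ∷ b ∷ c ∷ e ∷ d ∷ []))

coprime-system : ∀ {A B C E D ℓ₁ ℓ₂ b} (S : System A B C E D ℓ₁ ℓ₂ b) → b + 3 ≤ System.k₁ S → Coprime A ℓ₁ →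
  ℓ₁ + ℓ₂ + 2 ≤ System.k₁ S + System.k₂ S + b
coprime-system {A} {B} {C} {E} {D} {ℓ₁} {ℓ₂} {b} S large coprime with b + 3 ≤? System.k₂ S
... | yes large₂ = arith ℓ₁ ℓ₂ k₁ k₂ b _ _ _ (freiman-system S large coprime) (freiman-system (swap S) large₂ coprime₂) least-AB total
  where
  open System S
  coprime₂ : Coprime B ℓ₂
  coprime₂ h all = coprime h (common-divisor (swap S) large₂ h all)
  arith : ∀ ℓ₁ ℓ₂ k₁ k₂ b c e d → k₁ + ℓ₁ ≤ c → k₂ + ℓ₂ ≤ d → k₁ + k₂ ≤ suc e →
          c + e + d + 3 ≤ 3 * (k₁ + k₂) + b → ℓ₁ + ℓ₂ + 2 ≤ k₁ + k₂ + b
  arith ℓ₁ ℓ₂ k₁ k₂ b c e d p q r s = lin _ _ 0 (+-mono-≤ p (+-mono-≤ q (+-mono-≤ r s)))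
                                           (solve (ℓ₁ ∷ ℓ₂ ∷ k₁ ∷ k₂ ∷ b ∷ c ∷ e ∷ d ∷ []))
... | no ¬large₂ with dense-pair A C E ℓ₁ ℓ₂ A-first A-last sums-AA dense
                        (λ a a≤ℓ₁ Aa → subst (E ∋_) (+-identityʳ a) (sums-AB a 0 a≤ℓ₁ z≤n Aa B-first))
                        (λ a a≤ℓ₁ Aa → subst (E ∋_) (+-comm a ℓ₂) (sums-AB a ℓ₂ a≤ℓ₁ ≤-refl Aa B-last))
  where
  open System S
  arith : ∀ ℓ₁ k₁ k₂ b c e d → b + 3 ≤ k₁ → k₁ + ℓ₁ ≤ c → k₁ + k₂ ≤ suc e → 2 * k₂ ≤ suc d →
          c + e + d + 3 ≤ 3 * (k₁ + k₂) + b → ℓ₁ + 3 ≤ 2 * k₁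
  arith ℓ₁ k₁ k₂ b c e d o p q r s = lin _ _ 1 (+-mono-≤ o (+-mono-≤ p (+-mono-≤ q (+-mono-≤ r s))))
                                          (solve (ℓ₁ ∷ k₁ ∷ k₂ ∷ b ∷ c ∷ e ∷ d ∷ []))
  -- The bounds for the three sumsets and `total` give ℓ₁ ≤ k₁ + b - 1, while b ≤ k₁ - 3.
  dense : Dense A ℓ₁
  dense = arith ℓ₁ k₁ k₂ b _ _ _ large (freiman-system S large coprime) least-AB least-BB total
... | inj₁ h = arith ℓ₁ ℓ₂ (System.k₁ S) (System.k₂ S) b (System.s-AA S) (System.s-AB S) (System.s-BB S) h (System.least-BB S) (System.total S)
  where
  arith : ∀ ℓ₁ ℓ₂ k₁ k₂ b c e d → ℓ₁ + 2 * k₁ + ℓ₂ ≤ c + e → 2 * k₂ ≤ suc d →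
          c + e + d + 3 ≤ 3 * (k₁ + k₂) + b → ℓ₁ + ℓ₂ + 2 ≤ k₁ + k₂ + b
  arith ℓ₁ ℓ₂ k₁ k₂ b c e d p q s = lin _ _ 0 (+-mono-≤ p (+-mono-≤ q s))
                                         (solve (ℓ₁ ∷ ℓ₂ ∷ k₁ ∷ k₂ ∷ b ∷ c ∷ e ∷ d ∷ []))
-- Here 4k₁ - 1 sums force k₁ < k₂ + b; with k₂ ≤ b + 2 this gives k₁ + k₂ ≤ 3b + 3, against
-- `small`.
... | inj₂ h = ⊥-elim (1+n≰n (arith (System.k₁ S) (System.k₂ S) b (System.s-AA S) (System.s-AB S) (System.s-BB S) h (System.least-BB S) (System.total S) (System.small S) (≰⇒> ¬large₂)))
  where
  arith : ∀ k₁ k₂ b c e d → 4 * k₁ ≤ suc (c + e) → 2 * k₂ ≤ suc d → c + e + d + 3 ≤ 3 * (k₁ + k₂) + b →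
          3 * b + 7 ≤ k₁ + k₂ → suc k₂ ≤ b + 3 → 1 ≤ 0
  arith k₁ k₂ b c e d p q r s t = lin 1 0 3 (+-mono-≤ p (+-mono-≤ q (+-mono-≤ r (+-mono-≤ s (+-mono-≤ t t)))))
                                       (solve (k₁ ∷ k₂ ∷ b ∷ c ∷ e ∷ d ∷ []))

-- Dividing out the common divisor

dilate : ℕ → Pred → Pred
dilate g P i = P (g * i)

-- In each block of `suc g` points only the first is kept. For `cnt-dilate-≥` the others are
-- non-multiples, hence absent from `P`.
cnt-dilate-≤ : ∀ g P w → cnt (dilate (suc g) P) (suc w) ≤ cnt P (suc (suc g * w))
cnt-dilate-≤ g P zero rewrite *-zeroʳ g = ≤-refl
cnt-dilate-≤ g P (suc w) = begin
  bit (P (suc g * 0)) + cnt (1 ▸ dilate (suc g) P) (suc w)                 ≡⟨ cong (λ z → bit (P z) + cnt (1 ▸ dilate (suc g) P) (suc w)) (*-zeroʳ g) ⟩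
  bit (P 0) + cnt (1 ▸ dilate (suc g) P) (suc w)                           ≤⟨ +-mono-≤ (m≤m+n (bit (P 0)) (cnt (1 ▸ P) g))
    (cnt-mono (1 ▸ dilate (suc g) P) (dilate (suc g) (suc g ▸ P)) (suc w) (λ i _ → subst (P ∋_) (*-suc (suc g) i))) ⟩
  cnt P (suc g) + cnt (dilate (suc g) (suc g ▸ P)) (suc w)                 ≤⟨ +-monoʳ-≤ (cnt P (suc g)) (cnt-dilate-≤ g (suc g ▸ P) w) ⟩
  cnt P (suc g) + cnt (suc g ▸ P) (suc (suc g * w))                        ≡⟨ cnt-splitAt P (suc g) (suc (suc g * w))
    (trans (+-suc (suc g) (suc g * w)) (cong suc (sym (*-suc (suc g) w)))) ⟨
  cnt P (suc (suc g * suc w))                                              ∎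
  where open ≤-Reasoning

cnt-dilate-≥ : ∀ g P w → (∀ a → a ≤ suc g * w → P ∋ a → suc g ∣ a) → cnt P (suc (suc g * w)) ≤ cnt (dilate (suc g) P) (suc w)
cnt-dilate-≥ g P zero all rewrite *-zeroʳ g = ≤-refl
cnt-dilate-≥ g P (suc w) all = begin
  cnt P (suc (suc g * suc w))                                              ≡⟨ cnt-splitAt P (suc g) (suc (suc g * w))
    (trans (+-suc (suc g) (suc g * w)) (cong suc (sym (*-suc (suc g) w)))) ⟩
  bit (P 0) + cnt (1 ▸ P) g + cnt (suc g ▸ P) (suc (suc g * w))            ≤⟨ +-mono-≤
    (≤-reflexive (trans (cong (bit (P 0) +_) (cnt-none (1 ▸ P) g none)) (+-identityʳ _)))
    (cnt-dilate-≥ g (suc g ▸ P) w all′) ⟩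
  bit (P 0) + cnt (dilate (suc g) (suc g ▸ P)) (suc w)                     ≤⟨ +-mono-≤ (≤-reflexive (cong (λ z → bit (P z)) (sym (*-zeroʳ g))))
    (cnt-mono (dilate (suc g) (suc g ▸ P)) (1 ▸ dilate (suc g) P) (suc w) (λ i _ → subst (P ∋_) (sym (*-suc (suc g) i)))) ⟩
  bit (P (suc g * 0)) + cnt (1 ▸ dilate (suc g) P) (suc w)                 ∎
  where
  open ≤-Reasoning
  none : ∀ i → i < g → P (suc i) ≡ false
  none i i<g with P (suc i) in eq
  ... | false = refl
  ... | true  = ⊥-elim (>⇒∤ (s<s i<g) (all (suc i) (≤-trans (s≤s (<⇒≤ i<g)) (m≤m*n (suc g) (suc w))) eq))
  all′ : ∀ a → a ≤ suc g * w → P ∋ suc g + a → suc g ∣ a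
  all′ a a≤ Pa = ∣m+n∣m⇒∣n (all (suc g + a) (≤-trans (+-monoʳ-≤ (suc g) a≤) (≤-reflexive (sym (*-suc (suc g) w)))) Pa) ∣-refl

-- In steps of g the two pieces span w₁ + 1 and w₂ + 1 points, hence the 2 in `short`.
record Hull (A B : Pred) (ℓ₁ ℓ₂ b : ℕ) : Set where
  field
    g w₁ w₂   : ℕ
    g≥1       : 1 ≤ g
    length₁   : ℓ₁ ≡ g * w₁
    length₂   : ℓ₂ ≡ g * w₂
    multiple₁ : ∀ a → a ≤ ℓ₁ → A ∋ a → g ∣ a
    multiple₂ : ∀ a → a ≤ ℓ₂ → B ∋ a → g ∣ a
    short     : w₁ + w₂ + 2 ≤ cnt A (suc ℓ₁) + cnt B (suc ℓ₂) + b

dilate-sums : ∀ g X m Y n E → Sums X (g * m) Y (g * n) E → Sums (dilate g X) m (dilate g Y) n (dilate g E)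
dilate-sums g X m Y n E sums i j i≤m j≤n Xi Yj =
  subst (E ∋_) (sym (*-distribˡ-+ g i j)) (sums (g * i) (g * j) (*-monoʳ-≤ g i≤m) (*-monoʳ-≤ g j≤n) Xi Yj)

dilate-system : ∀ {A B C E D} g w₁ w₂ {b} → System A B C E D (suc g * w₁) (suc g * w₂) b →
  (∀ a → a ≤ suc g * w₁ → A ∋ a → suc g ∣ a) → (∀ a → a ≤ suc g * w₂ → B ∋ a → suc g ∣ a) →
  System (dilate (suc g) A) (dilate (suc g) B) (dilate (suc g) C) (dilate (suc g) E) (dilate (suc g) D) w₁ w₂ b
dilate-system {A} {B} {C} {E} {D} g w₁ w₂ {b} S all₁ all₂ = record
  { A-first = subst (A ∋_) (sym (*-zeroʳ (suc g))) A-first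
  ; A-last  = A-last
  ; B-first = subst (B ∋_) (sym (*-zeroʳ (suc g))) B-first
  ; B-last  = B-last
  ; sums-AA = dilate-sums (suc g) A w₁ A w₁ C sums-AA
  ; sums-AB = dilate-sums (suc g) A w₁ B w₂ E sums-AB
  ; sums-BB = dilate-sums (suc g) B w₂ B w₂ D sums-BB
  ; total   = ≤-trans (+-monoˡ-≤ 3 (+-mono-≤ (+-mono-≤ (shrink C w₁ w₁) (shrink E w₁ w₂)) (shrink D w₂ w₂)))
                (≤-trans total (+-monoˡ-≤ b (*-monoʳ-≤ 3 k≤)))
  ; small   = ≤-trans small k≤
  }
  where
  open System S
  shrink : ∀ P m n → cnt (dilate (suc g) P) (suc (m + n)) ≤ cnt P (suc (suc g * m + suc g * n))
  shrink P m n = ≤-trans (cnt-dilate-≤ g P (m + n)) (≤-reflexive (cong (λ z → cnt P (suc z)) (*-distribˡ-+ (suc g) m n)))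
  k≤ : cnt A (suc (suc g * w₁)) + cnt B (suc (suc g * w₂)) ≤ cnt (dilate (suc g) A) (suc w₁) + cnt (dilate (suc g) B) (suc w₂)
  k≤ = +-mono-≤ (cnt-dilate-≥ g A w₁ all₁) (cnt-dilate-≥ g B w₂ all₂)

hull-large : ∀ {A B C E D ℓ₁ ℓ₂ b} (S : System A B C E D ℓ₁ ℓ₂ b) → b + 3 ≤ System.k₁ S → Hull A B ℓ₁ ℓ₂ b
hull-large {A} {B} {C} {E} {D} {ℓ₁} {ℓ₂} {b} S large
  with gcdOf A (suc ℓ₁) | (λ a a≤ → gcdOf-∣ A (suc ℓ₁) a (s≤s a≤)) | gcdOf-greatest A (suc ℓ₁)
-- A gcd of 0 forces ℓ₁ = 0 and so k₁ ≤ 1, below b + 3.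
... | zero | all | _ = ⊥-elim (1+n≰n (≤-trans (≤-trans (s≤s (s≤s z≤n)) (≤-trans (m≤n+m 3 b) large))
                         (≤-trans (≤-reflexive (cong (λ z → cnt A (suc z)) (0∣⇒≡0 (all ℓ₁ ≤-refl (System.A-last S))))) (cnt-≤ A 1))))
... | suc g | all | greatest with all ℓ₁ ≤-refl (System.A-last S)
                              | common-divisor S large (suc g) all ℓ₂ ≤-refl (System.B-last S)
... | divides w₁ eq₁ | divides w₂ eq₂ with trans eq₁ (*-comm w₁ (suc g)) | trans eq₂ (*-comm w₂ (suc g))
... | refl | refl = record
  { g = suc g ; w₁ = w₁ ; w₂ = w₂ ; g≥1 = s≤s z≤n ; length₁ = refl ; length₂ = refl
  ; multiple₁ = all
  ; multiple₂ = all₂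
  ; short     = ≤-trans (coprime-system S′ (≤-trans large (cnt-dilate-≥ g A w₁ all)) coprime)
                  (+-monoˡ-≤ b (+-mono-≤ (cnt-dilate-≤ g A w₁) (cnt-dilate-≤ g B w₂)))
  }
  where
  all₂ : ∀ a → a ≤ suc g * w₂ → B ∋ a → suc g ∣ a
  all₂ = common-divisor S large (suc g) all
  S′ = dilate-system g w₁ w₂ S all all₂
  -- If h divides all the quotients, `suc g * h` divides every element of `A` and therefore the gcd
  -- `suc g`.
  coprime : Coprime (dilate (suc g) A) w₁
  coprime h h-all = ∣1⇒≡1 (*-cancelˡ-∣ (suc g) (subst (suc g * h ∣_) (sym (*-identityʳ (suc g))) (greatest (suc g * h) multiples)))
    where
    multiples : ∀ a → a < suc (suc g * w₁) → A ∋ a → suc g * h ∣ a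
    multiples a a< Aa with all a (s≤s⁻¹ a<) Aa
    ... | divides q eq with trans eq (*-comm q (suc g))
    ... | refl = *-monoʳ-∣ (suc g) (h-all q (*-cancelˡ-≤ (suc g) (s≤s⁻¹ a<)) Aa)

hull : ∀ {A B C E D ℓ₁ ℓ₂ b} → System A B C E D ℓ₁ ℓ₂ b → Hull A B ℓ₁ ℓ₂ b
hull {A} {B} {C} {E} {D} {ℓ₁} {ℓ₂} {b} S with b + 3 ≤? System.k₁ S
... | yes large = hull-large S large
-- Two sizes of at most b + 2 would add up to less than 3b + 7, so the other piece is large.
... | no ¬large with hull-large (swap S) (arith (System.k₁ S) (System.k₂ S) b (≰⇒> ¬large) (System.small S))
  where
  arith : ∀ k₁ k₂ b → suc k₁ ≤ b + 3 → 3 * b + 7 ≤ k₁ + k₂ → b + 3 ≤ k₂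
  arith k₁ k₂ b p q = lin _ _ (b + 2) (+-mono-≤ p q) (solve (k₁ ∷ k₂ ∷ b ∷ []))
... | H = record
  { g = g ; w₁ = w₂ ; w₂ = w₁ ; g≥1 = g≥1 ; length₁ = length₂ ; length₂ = length₁
  ; multiple₁ = multiple₂ ; multiple₂ = multiple₁
  ; short = arith w₁ w₂ (System.k₁ S) (System.k₂ S) b short
  }
  where
  open Hull H
  arith : ∀ w₁ w₂ k₁ k₂ b → w₁ + w₂ + 2 ≤ k₂ + k₁ + b → w₂ + w₁ + 2 ≤ k₁ + k₂ + b
  arith w₁ w₂ k₁ k₂ b p = lin _ _ 0 p (solve (w₁ ∷ w₂ ∷ k₁ ∷ k₂ ∷ b ∷ []))

-- From lists of numbers to index sets

unique-length : ∀ {xs ys : FinSet} → Unique xs → xs ⊆ ys → length xs ≤ length ys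
unique-length [] _ = z≤n
unique-length {x ∷ xs} (x∉xs ∷ unique) sub with ∈-∃++ (sub (here refl))
... | as , bs , refl = begin
  suc (length xs)               ≤⟨ s≤s (unique-length unique sub′) ⟩
  suc (length (as ++ bs))       ≡⟨ cong suc (length-++ as) ⟩
  suc (length as + length bs)   ≡⟨ +-suc (length as) (length bs) ⟨
  length as + suc (length bs)   ≡⟨ length-++ as ⟨
  length (as ++ x ∷ bs)         ∎
  where
  open ≤-Reasoning
  sub′ : xs ⊆ as ++ bs
  sub′ y∈xs with ∈-++⁻ as (sub (there y∈xs))
  ... | inj₁ y∈as         = ∈-++⁺ˡ y∈as
  ... | inj₂ (there y∈bs) = ∈-++⁺ʳ as y∈bs
  ... | inj₂ (here refl)  = ⊥-elim (lookup x∉xs y∈xs refl)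

card-≤ : ∀ {A ys : FinSet} → A ⊆ ys → card A ≤ length ys
card-≤ {A} sub = unique-length (deduplicate-! A) (sub ∘ ∈-deduplicate⁻ _≟_ A)

card-≥ : ∀ {A xs : FinSet} → Unique xs → xs ⊆ A → length xs ≤ card A
card-≥ unique sub = unique-length unique (∈-deduplicate⁺ _≟_ ∘ sub)

select : Pred → (ℕ → ℕ) → ℕ → FinSet
select P f zero    = []
select P f (suc n) with P 0
... | true  = f 0 ∷ select (1 ▸ P) (f ∘ suc) n
... | false = select (1 ▸ P) (f ∘ suc) n

length-select : ∀ P f n → length (select P f n) ≡ cnt P n
length-select P f zero = refl
length-select P f (suc n) with P 0
... | true  = cong suc (length-select (1 ▸ P) (f ∘ suc) n)
... | false = length-select (1 ▸ P) (f ∘ suc) n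

∈-select⁺ : ∀ P f n i → i < n → P ∋ i → f i ∈ select P f n
∈-select⁺ P f (suc n) i i<n Pi with P 0 in P0
∈-select⁺ P f (suc n) zero    _         Pi | true  = here refl
∈-select⁺ P f (suc n) zero    _         Pi | false = ⊥-elim (true≢false Pi P0)
∈-select⁺ P f (suc n) (suc i) (s≤s i<n) Pi | true  = there (∈-select⁺ (1 ▸ P) (f ∘ suc) n i i<n Pi)
∈-select⁺ P f (suc n) (suc i) (s≤s i<n) Pi | false = ∈-select⁺ (1 ▸ P) (f ∘ suc) n i i<n Pi

∈-select⁻ : ∀ P f n {x} → x ∈ select P f n → ∃[ i ] (i < n × P ∋ i × x ≡ f i)
∈-select⁻ P f (suc n) x∈ with P 0 in P0
∈-select⁻ P f (suc n) (here refl) | true = 0 , z<s , P0 , refl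
∈-select⁻ P f (suc n) (there x∈)  | true with ∈-select⁻ (1 ▸ P) (f ∘ suc) n x∈
... | i , i<n , Pi , eq = suc i , s<s i<n , Pi , eq
∈-select⁻ P f (suc n) x∈          | false with ∈-select⁻ (1 ▸ P) (f ∘ suc) n x∈
... | i , i<n , Pi , eq = suc i , s<s i<n , Pi , eq

select-unique : ∀ P f n → Injective _≡_ _≡_ f → Unique (select P f n)
select-unique P f zero    inj = []
select-unique P f (suc n) inj with P 0
... | false = select-unique (1 ▸ P) (f ∘ suc) n (suc-injective ∘ inj)
... | true  = tabulate fresh ∷ select-unique (1 ▸ P) (f ∘ suc) n (suc-injective ∘ inj)
  where
  fresh : ∀ {x} → x ∈ select (1 ▸ P) (f ∘ suc) n → f 0 ≢ x
  fresh x∈ f0≡x with ∈-select⁻ (1 ▸ P) (f ∘ suc) n x∈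
  ... | i , _ , _ , refl with inj f0≡x
  ... | ()

record Extent (P : Pred) (n : ℕ) : Set where
  field
    m ℓ    : ℕ
    inside : m + ℓ < n
    first  : P ∋ m
    last   : P ∋ m + ℓ
    within : ∀ i → i < n → P ∋ i → ∃[ a ] (a ≤ ℓ × m + a ≡ i)
    count  : cnt P n ≡ cnt (m ▸ P) (suc ℓ)

extent : ∀ P n i → i < n → P ∋ i → Extent P n
extent P n i i<n Pi with firstTrue P i Pi
... | m , m≤i , Pm , none with m≤n⇒∃[o]m+o≡n (≤-<-trans m≤i i<n)
... | N , refl with lastTrue (m ▸ P) (suc N) (subst (P ∋_) (sym (+-identityʳ m)) Pm) (s≤s z≤n)
... | ℓ , t , ℓ+t≡N , Pℓ , gap = record
  { m = m ; ℓ = ℓ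
  ; inside = s≤s (+-monoʳ-≤ m (≤-trans (m≤m+n ℓ t) (≤-reflexive (suc-injective ℓ+t≡N))))
  ; first = Pm ; last = Pℓ ; within = within ; count = count }
  where
  length-eq : m + (suc ℓ + t) ≡ suc (m + N)
  length-eq = trans (cong (m +_) ℓ+t≡N) (+-suc m N)
  within : ∀ j → j < suc (m + N) → P ∋ j → ∃[ a ] (a ≤ ℓ × m + a ≡ j)
  within j j<n Pj with m ≤? j
  ... | no m≰j = ⊥-elim (true≢false Pj (none j (≰⇒> m≰j)))
  ... | yes m≤j with m≤n⇒∃[o]m+o≡n m≤j
  ... | a , refl with a ≤? ℓ
  ... | yes a≤ℓ = a , a≤ℓ , refl
  ... | no a≰ℓ with m≤n⇒∃[o]m+o≡n (≰⇒> a≰ℓ)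
  ... | o , refl = ⊥-elim (true≢false Pj (gap o (+-cancelˡ-< (m + suc ℓ) o t
                     (subst₂ _<_ (sym (+-assoc m (suc ℓ) o)) (trans (sym length-eq) (sym (+-assoc m (suc ℓ) t))) j<n))))
  count : cnt P (suc (m + N)) ≡ cnt (m ▸ P) (suc ℓ)
  count = begin
    cnt P (suc (m + N))                                     ≡⟨ cnt-splitAt P m (suc ℓ + t) length-eq ⟩
    cnt P m + cnt (m ▸ P) (suc ℓ + t)                       ≡⟨ cong₂ _+_ (cnt-none P m none) (cnt-split (m ▸ P) (suc ℓ) t) ⟩
    cnt (m ▸ P) (suc ℓ) + cnt (suc ℓ ▸ (m ▸ P)) t           ≡⟨ cong (cnt (m ▸ P) (suc ℓ) +_) (cnt-none (suc ℓ ▸ (m ▸ P)) t gap) ⟩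
    cnt (m ▸ P) (suc ℓ) + 0                                 ≡⟨ +-identityʳ _ ⟩
    cnt (m ▸ P) (suc ℓ)                                     ∎
    where open ≡-Reasoning

split-index : ∀ m n t → t ≤ m + n → ∃[ i ] ∃[ j ] (i ≤ m × j ≤ n × i + j ≡ t)
split-index m n t t≤ with ≤-total t m
... | inj₁ t≤m = t , 0 , t≤m , z≤n , +-identityʳ t
... | inj₂ m≤t with m≤n⇒∃[o]m+o≡n m≤t
... | j , refl = m , j , ≤-refl , +-cancelˡ-≤ m j n t≤ , refl

module Progressions (A : FinSet) (d : ℕ) (d≥1 : 1 ≤ d) where

  term : ℕ → ℕ → ℕ
  term a i = a + i * d

  term-injective : ∀ a → Injective _≡_ _≡_ (term a)
  term-injective a {i} {j} eq = *-cancelʳ-≡ i j d {{>-nonZero d≥1}} (+-cancelˡ-≡ a (i * d) (j * d) eq)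

  term-+ : ∀ a a′ i j → term a i + term a′ j ≡ term (a + a′) (i + j)
  term-+ a a′ i j = trans (interchange a (i * d) a′ (j * d)) (cong (a + a′ +_) (sym (*-distribʳ-+ d i j)))

  term-step : ∀ a m g i → term a m + i * (g * d) ≡ term a (m + g * i)
  term-step a m g i = eq a m g i d
    where
    eq : ∀ a m g i d → a + m * d + i * (g * d) ≡ a + (m + g * i) * d
    eq a m g i d = solve (a ∷ m ∷ g ∷ i ∷ d ∷ [])

  indices : FinSet → ℕ → Pred
  indices B a i = does (term a i ∈? B)

  indices⁺ : ∀ B a i → term a i ∈ B → indices B a ∋ i
  indices⁺ B a i = dec-true (term a i ∈? B)

  indices⁻ : ∀ B a i → indices B a ∋ i → term a i ∈ B
  indices⁻ B a i = witness (term a i ∈? B)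

  index-sums : ∀ a a′ m m′ ℓ ℓ′ → Sums (m ▸ indices A a) ℓ (m′ ▸ indices A a′) ℓ′ ((m + m′) ▸ indices (A ⊕ A) (a + a′))
  index-sums a a′ m m′ ℓ ℓ′ i j _ _ Ai Aj = indices⁺ (A ⊕ A) (a + a′) (m + m′ + (i + j)) (subst (_∈ A ⊕ A)
    (trans (term-+ a a′ (m + i) (m′ + j)) (cong (term (a + a′)) (interchange m i m′ j)))
    (∈-cartesianProductWith⁺ _+_ (indices⁻ A a (m + i) Ai) (indices⁻ A a′ (m′ + j) Aj)))

  record Enumerates (I : FinSet) (a n : ℕ) : Set where
    field
      to   : ∀ {x} → x ∈ I → ∃[ i ] (i < n × x ≡ term a i)
      from : ∀ {i} → i < n → term a i ∈ I

  isAP⇒Enumerates : ∀ {n I} (ap : IsAP d n I) → Enumerates I (proj₁ (IsAP.terms ap)) n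
  isAP⇒Enumerates {n} ap = record
    { to   = λ x∈I → ∈-applyUpTo⁻ (term a) (Equivalence.to I≈ x∈I)
    ; from = λ i<n → Equivalence.from I≈ (∈-applyUpTo⁺ (term a) i<n) }
    where
    a = proj₁ (IsAP.terms ap)
    I≈ = λ {x} → proj₂ (IsAP.terms ap) {x}

  -- Two progressions of the same difference have a sum without holes, so a point of the sumset
  -- picked by its index alone lies in the right one of `I ⊕ I`, `I ⊕ J` and `J ⊕ J`, and the three
  -- index counts do not overlap.
  ∈-⊕ : ∀ {I J a a′ m n} → Enumerates I a (suc m) → Enumerates J a′ (suc n) → ∀ {t} → t < suc (m + n) → term (a + a′) t ∈ I ⊕ J
  ∈-⊕ {I} {J} {a} {a′} {m} {n} isI isJ {t} t< with split-index m n t (s≤s⁻¹ t<)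
  ... | i , j , i≤m , j≤n , refl = subst (_∈ I ⊕ J) (term-+ a a′ i j)
          (∈-cartesianProductWith⁺ _+_ (Enumerates.from isI (s≤s i≤m)) (Enumerates.from isJ (s≤s j≤n)))

  select-⊆ : ∀ B a n → select (indices B a) (term a) n ⊆ B
  select-⊆ B a n x∈ with ∈-select⁻ (indices B a) (term a) n x∈
  ... | i , _ , Bi , refl = indices⁻ B a i Bi

  select-in : ∀ B a n {K : FinSet} → (∀ {i} → i < n → term a i ∈ K) → select (indices B a) (term a) n ⊆ K
  select-in B a n terms x∈ with ∈-select⁻ (indices B a) (term a) n x∈
  ... | i , i<n , _ , refl = terms i<n

  unique : ∀ B a n → Unique (select (indices B a) (term a) n)
  unique B a n = select-unique (indices B a) (term a) n (term-injective a)

  len : ∀ B a n → length (select (indices B a) (term a) n) ≡ cnt (indices B a) n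
  len B a n = length-select (indices B a) (term a) n

  module _ (I J : FinSet) (a₁ a₂ n₁ n₂ : ℕ) (isI : Enumerates I a₁ (suc n₁)) (isJ : Enumerates J a₂ (suc n₂))
           (II-IJ : Disjoint (I ⊕ I) (I ⊕ J)) (II-JJ : Disjoint (I ⊕ I) (J ⊕ J)) (IJ-JJ : Disjoint (I ⊕ J) (J ⊕ J))
           (A⊆ : A ⊆ I ++ J) (meetsI : A meets I) (meetsJ : A meets J) where

    -- A common point x would put x + x into both `I ⊕ I` and `I ⊕ J`.
    I-J : Disjoint I J
    I-J (x∈I , x∈J) = II-IJ (∈-cartesianProductWith⁺ _+_ x∈I x∈I , ∈-cartesianProductWith⁺ _+_ x∈I x∈J)

    P₁ P₂ C₁ C₁₂ C₂ : Pred
    P₁  = indices A a₁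
    P₂  = indices A a₂
    C₁  = indices (A ⊕ A) (a₁ + a₁)
    C₁₂ = indices (A ⊕ A) (a₁ + a₂)
    C₂  = indices (A ⊕ A) (a₂ + a₂)

    card-A : card A ≡ cnt P₁ (suc n₁) + cnt P₂ (suc n₂)
    card-A = trans (≤-antisym (card-≤ covers) (card-≥ (++⁺ (unique A a₁ (suc n₁)) (unique A a₂ (suc n₂)) disjoint) sub))
                   (trans (length-++ L₁) (cong₂ _+_ (len A a₁ (suc n₁)) (len A a₂ (suc n₂))))
      where
      L₁ = select P₁ (term a₁) (suc n₁)
      L₂ = select P₂ (term a₂) (suc n₂)
      covers : A ⊆ L₁ ++ L₂
      covers x∈A with ∈-++⁻ I (A⊆ x∈A)
      ... | inj₁ x∈I with Enumerates.to isI x∈I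
      ... | i , i<n , refl = ∈-++⁺ˡ (∈-select⁺ P₁ (term a₁) (suc n₁) i i<n (indices⁺ A a₁ i x∈A))
      covers x∈A | inj₂ x∈J with Enumerates.to isJ x∈J
      ... | i , i<n , refl = ∈-++⁺ʳ L₁ (∈-select⁺ P₂ (term a₂) (suc n₂) i i<n (indices⁺ A a₂ i x∈A))
      disjoint : Disjoint L₁ L₂
      disjoint (x∈ , y∈) = I-J (select-in A a₁ (suc n₁) (Enumerates.from isI) x∈ , select-in A a₂ (suc n₂) (Enumerates.from isJ) y∈)
      sub : L₁ ++ L₂ ⊆ A
      sub x∈ with ∈-++⁻ L₁ x∈
      ... | inj₁ x∈L₁ = select-⊆ A a₁ (suc n₁) x∈L₁
      ... | inj₂ x∈L₂ = select-⊆ A a₂ (suc n₂) x∈L₂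

    card-2A : cnt C₁ (suc (n₁ + n₁)) + cnt C₁₂ (suc (n₁ + n₂)) + cnt C₂ (suc (n₂ + n₂)) ≤ card (A ⊕ A)
    card-2A = begin
      cnt C₁ (suc (n₁ + n₁)) + cnt C₁₂ (suc (n₁ + n₂)) + cnt C₂ (suc (n₂ + n₂))
        ≡⟨ cong₂ _+_ (cong₂ _+_ (len (A ⊕ A) (a₁ + a₁) (suc (n₁ + n₁))) (len (A ⊕ A) (a₁ + a₂) (suc (n₁ + n₂)))) (len (A ⊕ A) (a₂ + a₂) (suc (n₂ + n₂))) ⟨
      length L₁ + length L₁₂ + length L₂        ≡⟨ cong (_+ length L₂) (length-++ L₁) ⟨
      length (L₁ ++ L₁₂) + length L₂            ≡⟨ length-++ (L₁ ++ L₁₂) ⟨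
      length ((L₁ ++ L₁₂) ++ L₂)                ≤⟨ card-≥ (++⁺ (++⁺ u₁ u₁₂ d₁) u₂ d₂) sub ⟩
      card (A ⊕ A)                              ∎
      where
      open ≤-Reasoning
      L₁  = select C₁ (term (a₁ + a₁)) (suc (n₁ + n₁))
      L₁₂ = select C₁₂ (term (a₁ + a₂)) (suc (n₁ + n₂))
      L₂  = select C₂ (term (a₂ + a₂)) (suc (n₂ + n₂))
      u₁ : Unique L₁
      u₁ = unique (A ⊕ A) (a₁ + a₁) (suc (n₁ + n₁))
      u₁₂ : Unique L₁₂
      u₁₂ = unique (A ⊕ A) (a₁ + a₂) (suc (n₁ + n₂))
      u₂ : Unique L₂
      u₂ = unique (A ⊕ A) (a₂ + a₂) (suc (n₂ + n₂))
      in₁ : L₁ ⊆ I ⊕ I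
      in₁ = select-in (A ⊕ A) (a₁ + a₁) (suc (n₁ + n₁)) (∈-⊕ isI isI)
      in₁₂ : L₁₂ ⊆ I ⊕ J
      in₁₂ = select-in (A ⊕ A) (a₁ + a₂) (suc (n₁ + n₂)) (∈-⊕ isI isJ)
      in₂ : L₂ ⊆ J ⊕ J
      in₂ = select-in (A ⊕ A) (a₂ + a₂) (suc (n₂ + n₂)) (∈-⊕ isJ isJ)
      d₁ : Disjoint L₁ L₁₂
      d₁ (x∈ , y∈) = II-IJ (in₁ x∈ , in₁₂ y∈)
      d₂ : Disjoint (L₁ ++ L₁₂) L₂
      d₂ (x∈ , y∈) with ∈-++⁻ L₁ x∈
      ... | inj₁ x∈L₁  = II-JJ (in₁ x∈L₁ , in₂ y∈)
      ... | inj₂ x∈L₁₂ = IJ-JJ (in₁₂ x∈L₁₂ , in₂ y∈)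
      sub : (L₁ ++ L₁₂) ++ L₂ ⊆ A ⊕ A
      sub x∈ with ∈-++⁻ (L₁ ++ L₁₂) x∈
      ... | inj₂ x∈L₂ = select-⊆ (A ⊕ A) (a₂ + a₂) (suc (n₂ + n₂)) x∈L₂
      ... | inj₁ x∈L with ∈-++⁻ L₁ x∈L
      ... | inj₁ x∈L₁  = select-⊆ (A ⊕ A) (a₁ + a₁) (suc (n₁ + n₁)) x∈L₁
      ... | inj₂ x∈L₁₂ = select-⊆ (A ⊕ A) (a₁ + a₂) (suc (n₁ + n₂)) x∈L₁₂

    extent-of : ∀ {K a n} → Enumerates K a (suc n) → A meets K → Extent (indices A a) (suc n)
    extent-of {a = a} {n} isK (x , x∈A , x∈K) with Enumerates.to isK x∈K
    ... | i , i<n , refl = extent (indices A a) (suc n) i i<n (indices⁺ A a i x∈A)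

    open Extent (extent-of isI meetsI) renaming (m to m₁; ℓ to ℓ₁; inside to inside₁; first to first₁; last to last₁; within to within₁; count to count₁)
    open Extent (extent-of isJ meetsJ) renaming (m to m₂; ℓ to ℓ₂; inside to inside₂; first to first₂; last to last₂; within to within₂; count to count₂)

    card-extents : card A ≡ cnt (m₁ ▸ P₁) (suc ℓ₁) + cnt (m₂ ▸ P₂) (suc ℓ₂)
    card-extents = trans card-A (cong₂ _+_ count₁ count₂)

    system : ∀ b → card (A ⊕ A) + 3 ≤ 3 * card A + b → 3 * b + 7 ≤ card A →
             System (m₁ ▸ P₁) (m₂ ▸ P₂) ((m₁ + m₁) ▸ C₁) ((m₁ + m₂) ▸ C₁₂) ((m₂ + m₂) ▸ C₂) ℓ₁ ℓ₂ b
    system b sumset-size b-small = record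
      { A-first = subst (P₁ ∋_) (sym (+-identityʳ m₁)) first₁
      ; A-last  = last₁
      ; B-first = subst (P₂ ∋_) (sym (+-identityʳ m₂)) first₂
      ; B-last  = last₂
      ; sums-AA = index-sums a₁ a₁ m₁ m₁ ℓ₁ ℓ₁
      ; sums-AB = index-sums a₁ a₂ m₁ m₂ ℓ₁ ℓ₂
      ; sums-BB = index-sums a₂ a₂ m₂ m₂ ℓ₂ ℓ₂
      ; total   = ≤-trans (+-monoˡ-≤ 3 (≤-trans (+-mono-≤ (+-mono-≤
                    (shift C₁ m₁ m₁ ℓ₁ ℓ₁ n₁ n₁ inside₁ inside₁) (shift C₁₂ m₁ m₂ ℓ₁ ℓ₂ n₁ n₂ inside₁ inside₂))
                    (shift C₂ m₂ m₂ ℓ₂ ℓ₂ n₂ n₂ inside₂ inside₂)) card-2A))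
                    (subst (λ k → card (A ⊕ A) + 3 ≤ 3 * k + b) card-extents sumset-size)
      ; small   = ≤-trans b-small (≤-reflexive card-extents)
      }
      where
      shift : ∀ C m m′ ℓ ℓ′ n n′ → m + ℓ < suc n → m′ + ℓ′ < suc n′ → cnt ((m + m′) ▸ C) (suc (ℓ + ℓ′)) ≤ cnt C (suc (n + n′))
      shift C m m′ ℓ ℓ′ n n′ p q = cnt-shift C (m + m′) (suc (ℓ + ℓ′)) (≤-trans (≤-reflexive (trans (+-suc (m + m′) (ℓ + ℓ′))
        (cong suc (interchange m m′ ℓ ℓ′)))) (s≤s (+-mono-≤ (s≤s⁻¹ p) (s≤s⁻¹ q))))

    -- The shortened progressions

    module _ {b} (H : Hull (m₁ ▸ P₁) (m₂ ▸ P₂) ℓ₁ ℓ₂ b) where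
      open Hull H

      -- Each starts at the least element of `A` in its progression and keeps every g-th term up to
      -- the greatest. Being subsets of `I` and `J`, they inherit the disjointness of the sums.
      I′ J′ : FinSet
      I′ = progression (term a₁ m₁) (g * d) (suc w₁)
      J′ = progression (term a₂ m₂) (g * d) (suc w₂)

      sub-progression : ∀ {K a n m ℓ w} → Enumerates K a (suc n) → m + ℓ < suc n → ℓ ≡ g * w →
                        progression (term a m) (g * d) (suc w) ⊆ K
      sub-progression {K} {a} {n} {m} {w = w} isK in-K refl x∈ with ∈-applyUpTo⁻ (λ i → term a m + i * (g * d)) x∈
      ... | i , i<w , refl = subst (_∈ K) (sym (term-step a m g i))
              (Enumerates.from isK (≤-trans (s≤s (+-monoʳ-≤ m (*-monoʳ-≤ g (s≤s⁻¹ i<w)))) in-K))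

      in-progression : ∀ a m i q w → q * g ≤ g * w → m + q * g ≡ i → term a i ∈ progression (term a m) (g * d) (suc w)
      in-progression a m i q w q≤ refl = subst (_∈ progression (term a m) (g * d) (suc w))
        (trans (term-step a m g q) (cong (λ z → term a (m + z)) (*-comm g q)))
        (∈-applyUpTo⁺ (λ i → term a m + i * (g * d))
          (s≤s (*-cancelˡ-≤ g {{>-nonZero g≥1}} (subst (_≤ g * w) (*-comm q g) q≤))))

      I′⊆I : I′ ⊆ I
      I′⊆I = sub-progression isI inside₁ length₁

      J′⊆J : J′ ⊆ J
      J′⊆J = sub-progression isJ inside₂ length₂

      A⊆I′J′ : A ⊆ I′ ++ J′
      A⊆I′J′ x∈A with ∈-++⁻ I (A⊆ x∈A)
      A⊆I′J′ x∈A | inj₁ x∈I with Enumerates.to isI x∈I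
      ... | i , i<n , refl with within₁ i i<n (indices⁺ A a₁ i x∈A)
      ... | a , a≤ℓ , refl with multiple₁ a a≤ℓ (indices⁺ A a₁ (m₁ + a) x∈A)
      ... | divides q refl = ∈-++⁺ˡ (in-progression a₁ m₁ _ q w₁ (≤-trans a≤ℓ (≤-reflexive length₁)) refl)
      A⊆I′J′ x∈A | inj₂ x∈J with Enumerates.to isJ x∈J
      ... | i , i<n , refl with within₂ i i<n (indices⁺ A a₂ i x∈A)
      ... | a , a≤ℓ , refl with multiple₂ a a≤ℓ (indices⁺ A a₂ (m₂ + a) x∈A)
      ... | divides q refl = ∈-++⁺ʳ I′ (in-progression a₂ m₂ _ q w₂ (≤-trans a≤ℓ (≤-reflexive length₂)) refl)

      meets′ : ∀ a m w → indices A a ∋ m → A meets progression (term a m) (g * d) (suc w)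
      meets′ a m w Am = term a m , indices⁻ A a m Am , here (sym (+-identityʳ (term a m)))

      isAP′ : ∀ a w → IsAP (g * d) (suc w) (progression a (g * d) (suc w))
      isAP′ a w = record { d≥1 = *-mono-≤ g≥1 d≥1 ; k≥1 = s≤s z≤n ; terms = a , mk⇔ id id }

      ⊕-mono : ∀ {X X′ Y Y′ : FinSet} → X′ ⊆ X → Y′ ⊆ Y → X′ ⊕ Y′ ⊆ X ⊕ Y
      ⊕-mono {X′ = X′} {Y′ = Y′} X′⊆X Y′⊆Y z∈ with ∈-cartesianProductWith⁻ _+_ X′ Y′ z∈
      ... | x , y , x∈ , y∈ , refl = ∈-cartesianProductWith⁺ _+_ (X′⊆X x∈) (Y′⊆Y y∈)

      isBiAP′ : IsBiAP (g * d) (card I′ + card J′) I′ J′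
      isBiAP′ = record
        { I-isAP = suc w₁ , isAP′ (term a₁ m₁) w₁
        ; J-isAP = suc w₂ , isAP′ (term a₂ m₂) w₂
        ; size   = refl
        ; II-IJ  = λ (x∈ , y∈) → II-IJ (⊕-mono I′⊆I I′⊆I x∈ , ⊕-mono I′⊆I J′⊆J y∈)
        ; II-JJ  = λ (x∈ , y∈) → II-JJ (⊕-mono I′⊆I I′⊆I x∈ , ⊕-mono J′⊆J J′⊆J y∈)
        ; IJ-JJ  = λ (x∈ , y∈) → IJ-JJ (⊕-mono I′⊆I J′⊆J x∈ , ⊕-mono J′⊆J J′⊆J y∈)
        }

      size-bound : card I′ + card J′ ≤ card A + b
      size-bound = begin
        card I′ + card J′          ≤⟨ +-mono-≤ (card-≤ {I′} id) (card-≤ {J′} id) ⟩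
        length I′ + length J′      ≡⟨ cong₂ _+_ (length-progression (term a₁ m₁) (suc w₁)) (length-progression (term a₂ m₂) (suc w₂)) ⟩
        suc w₁ + suc w₂            ≡⟨ eq w₁ w₂ ⟩
        w₁ + w₂ + 2                ≤⟨ short ⟩
        cnt (m₁ ▸ P₁) (suc ℓ₁) + cnt (m₂ ▸ P₂) (suc ℓ₂) + b    ≡⟨ cong (_+ b) card-extents ⟨
        card A + b                 ∎
        where
        open ≤-Reasoning
        length-progression : ∀ a n → length (progression a (g * d) n) ≡ n
        length-progression a n = length-applyUpTo (λ i → a + i * (g * d)) n
        eq : ∀ x y → suc x + suc y ≡ x + y + 2
        eq x y = solve (x ∷ y ∷ [])

    bi-progression : ∀ b → card (A ⊕ A) + 3 ≤ 3 * card A + b → 3 * b + 7 ≤ card A →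
      ∃[ I′ ] ∃[ J′ ] ∃[ d′ ] ∃[ l′ ] (IsBiAP d′ l′ I′ J′ × A ⊆ I′ ++ J′ × A meets I′ × A meets J′ × card I′ + card J′ ≤ card A + b)
    bi-progression b sumset-size b-small =
      I′ H , J′ H , _ , _ , isBiAP′ H , A⊆I′J′ H , meets′ H a₁ m₁ (Hull.w₁ H) first₁ , meets′ H a₂ m₂ (Hull.w₂ H) first₂ , size-bound H
      where
      H : Hull (m₁ ▸ P₁) (m₂ ▸ P₂) ℓ₁ ℓ₂ b
      H = hull (system b sumset-size b-small)

theorem1p3 : (A I J : FinSet) (d l k b : ℕ) →
    IsBiAP d l I J →
    A ⊆ I ++ J →
    A meets I →
    A meets J →
    card A ≡ k →
    k > 10 →
    card (A ⊕ A) ≡ 3 * k ∸ 3 + b →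
    3 * b + 6 < k →
    ∃[ I′ ] ∃[ J′ ] ∃[ d′ ] ∃[ l′ ] (IsBiAP d′ l′ I′ J′ × A ⊆ I′ ++ J′ × A meets I′ × A meets J′ × card I′ + card J′ ≤ k + b)
theorem1p3 A I J d l _ b biAP A⊆ meetsI meetsJ refl k>10 card-2A b-small
  with IsBiAP.I-isAP biAP | IsBiAP.J-isAP biAP
... | suc n₁ , I-isAP | suc n₂ , J-isAP =
  bi-progression I J _ _ n₁ n₂ (isAP⇒Enumerates I-isAP) (isAP⇒Enumerates J-isAP) II-IJ II-JJ IJ-JJ A⊆ meetsI meetsJ b
    (≤-reflexive (begin
      card (A ⊕ A) + 3             ≡⟨ cong (_+ 3) card-2A ⟩
      3 * card A ∸ 3 + b + 3       ≡⟨ +-assoc (3 * card A ∸ 3) b 3 ⟩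
      3 * card A ∸ 3 + (b + 3)     ≡⟨ cong (3 * card A ∸ 3 +_) (+-comm b 3) ⟩
      3 * card A ∸ 3 + (3 + b)     ≡⟨ +-assoc (3 * card A ∸ 3) 3 b ⟨
      -- Here k > 10 gives 3 ≤ 3k, so the truncated subtraction is undone exactly.
      3 * card A ∸ 3 + 3 + b       ≡⟨ cong (_+ b) (m∸n+n≡m (≤-trans (≤-trans (s≤s (s≤s (s≤s z≤n))) k>10) (m≤n*m (card A) 3))) ⟩
      3 * card A + b               ∎))
    (≤-trans (≤-reflexive (+-suc (3 * b) 6)) b-small)
  where
  open IsBiAP biAP using (II-IJ; II-JJ; IJ-JJ)
  open Progressions A d (IsAP.d≥1 I-isAP) using (isAP⇒Enumerates; bi-progression)
  open ≡-Reasoning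
... | zero , I-isAP | _ = ⊥-elim (1+n≰n (IsAP.k≥1 I-isAP))
... | suc _ , _ | zero , J-isAP = ⊥-elim (1+n≰n (IsAP.k≥1 J-isAP))
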